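{- Let $\widetilde{\mathcal{G}}_{\mathrm{c-c}} \subseteq \widetilde{\mathcal{G}}$ be the set of functions of cumulant-to-cumulant type. (1) If $g_1, g_2 \in \widetilde{\mathcal{G}}_{\mathrm{c-c}}$, then $g_1 * g_2 \in \widetilde{\mathcal{G}}_{\mathrm{c-c}}$. (2) If $g \in \widetilde{\mathcal{G}}_{\mathrm{c-c}}$, then $g^{ -1} \in \widetilde{\mathcal{G}}_{\mathrm{c-c}}$, where $g^{ -1}$ is the inverse of $g$ under convolution.
   Context: For $n \ge 1$, $NC(n)$ is the set of non-crossing partitions of $\{1,\ldots,n\}$, partially ordered by reverse refinement: $\pi \le \sigma$ iff every block of $\sigma$ is a union of blocks of $\pi$. $1_n \in NC(n)$ is the partition with a single block. Put $NC^{(2)} := \sqcup_{n=1}^{\infty} \{ (\pi,\sigma) \mid \pi,\sigma \in NC(n),\ \pi \le \sigma \}$. For $\pi \in NC(n)$ and a non-empty $W = \{p_1 < \cdots < p_m\} \subseteq \{1,\ldots,n\}$, $\pi_W \in NC(m)$ is the partition for which $i,j$ are in the same block of $\pi_W$ iff $p_i,p_j$ are in the same block of $\pi$. $\widetilde{\mathcal{G}}$ is the set of functions $g : NC^{(2)} \to \mathbb{C}$ such that $g(\pi,\pi)=1$ for all $\pi$ and $g(\pi,\sigma) = \prod_{W \in \sigma} g(\pi_W, 1_{|W|})$ for every $n \ge 1$ and $\pi \le \sigma$ in $NC(n)$. It is a group under convolution, $(f*g)(\pi,\sigma) = \sum_{\rho:\ \pi \le \rho \le \sigma} f(\pi,\rho)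 g(\rho,\sigma)$, with unit $e$ given by $e(\pi,\sigma)=1$ if $\pi=\sigma$ and $0$ otherwise. For $\pi_1 \in NC(n_1)$, $\pi_2 \in NC(n_2)$, the concatenation $\pi_1 \diamond \pi_2 \in NC(n_1+n_2)$ is obtained by placing $\pi_1$ on the points $1,\ldots,n_1$ and $\pi_2$ on the points $n_1+1,\ldots,n_1+n_2$. A function $g \in \widetilde{\mathcal{G}}$ is of cumulant-to-cumulant type if $g(\pi_1 \diamond \pi_2, 1_{n_1+n_2}) = 0$ for all $n_1,n_2 \ge 1$, $\pi_1 \in NC(n_1)$, $\pi_2 \in NC(n_2)$. $\widetilde{\mathcal{G}}_{\mathrm{c-c}}$ denotes the set of such functions. -}

module Defs where

open import Algebra.Bundles using (CommutativeRing)
open import Data.Bool.Base using (true; if_then_else_)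
import Data.Bool.Properties as Bool
open import Data.Fin.Base using (Fin; zero; suc; _<_; _≤_; splitAt)
open import Data.Fin.Properties using (all?; _<?_; _≤?_)
open import Data.Fin.Subset using (Subset; inside; outside; _∈_; _⊆_; ∣_∣; ⋃)
open import Data.Fin.Subset.Properties
  using (_∈?_; ⊆-antisym; ∉⊥; p⊆p∪q; q⊆p∪q; x∈p∪q⁻)
open import Data.List.Base as List using (List; []; _∷_; allFin; cartesianProductWith; filter; foldr; mapMaybe)
open import Data.List.Membership.Propositional renaming (_∈_ to _∈ˡ_)
open import Data.List.Membership.Propositional.Properties
  using (∈-map⁺; ∈-map⁻; ∈-filter⁺; ∈-filter⁻; ∈-allFin)
open import Data.List.Relation.Unary.All as All using (All; []; _∷_)
open import Data.List.Relation.Unary.Any using (here; there)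
open import Data.Maybe.Base using (Maybe; just; nothing)
open import Data.Nat.Base as ℕ using (ℕ; zero; suc; NonZero; _+_; z≤n; s≤s; z<s; s<s; s<s⁻¹)
open import Data.Product.Base using (_×_; _,_; ∃-syntax; proj₂)
open import Data.Sum.Base using (_⊎_; inj₁; inj₂)
open import Data.Sum.Relation.Binary.LeftOrder using (_⊎-<_; ₁∼₂; ₁∼₁; ₂∼₂)
open import Data.Sum.Relation.Binary.Pointwise
  using (Pointwise; inj₁; inj₂; ⊎-refl; ⊎-symmetric; ⊎-transitive; ⊎-decidable)
open import Data.Unit.Base using (⊤; tt)
open import Data.Vec.Base as Vec using (Vec; []; _∷_; here; there; lookup; tabulate)
open import Data.Vec.Properties using (≡-dec; lookup∘tabulate; []=⇒lookup; lookup⇒[]=)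
open import Function.Base using (_∘_; _on_; id)
open import Level using (0ℓ)
open import Relation.Binary.Core using (Rel)
open import Relation.Binary.Definitions using (Decidable)
open import Relation.Binary.Structures using (IsEquivalence)
import Relation.Binary.Construct.On as On
open import Relation.Binary.PropositionalEquality
  using (_≡_; refl; sym; trans; cong; subst)
open import Relation.Nullary.Decidable
  using (Dec; yes; no; does; map′; recompute; _×-dec_; _→-dec_)
open import Relation.Nullary.Negation using (contradiction)
open import Relation.Unary using (Pred) renaming (Decidable to Decidable₁)

private
  variable
    m n : ℕ

NonCrossing : Rel (Fin n) 0ℓ → Set
NonCrossing _∼_ = ∀ {i j k l} → i < j → j < k → k < l → i ∼ k → j ∼ l → i ∼ j

-- A partition is stored through the table i ↦ (the block containing i).
-- The laws are irrelevant, so that two partitions with the same blocks are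
-- propositionally equal.

record NC (n : ℕ) : Set where
  constructor mkNC
  field
    table          : Vec (Subset n) n
    .isEquivalence : IsEquivalence (λ i j → j ∈ lookup table i)
    .nonCrossing   : NonCrossing   (λ i j → j ∈ lookup table i)

  block : Fin n → Subset n
  block = lookup table

  infix 4 _∼_
  _∼_ : Rel (Fin n) 0ℓ
  i ∼ j = j ∈ block i

open NC public using (table; block)

infix 4 SameBlock SameBlock?
SameBlock : NC n → Rel (Fin n) 0ℓ
SameBlock = NC._∼_

syntax SameBlock π i j = i ∼[ π ] j

SameBlock? : (π : NC n) → Decidable (SameBlock π)
SameBlock? π i j = j ∈? block π i

module _ {_∼_ : Rel (Fin n) 0ℓ} (_∼?_ : Decidable _∼_) where

  isEquivalence? : Dec (IsEquivalence _∼_)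
  isEquivalence? = map′
    (λ (r , s , t) → record
      { refl  = r _
      ; sym   = s _ _
      ; trans = t _ _ _
      })
    (λ eq → let open IsEquivalence eq renaming (refl to r; sym to s; trans to t) in
      (λ _ → r) , (λ _ _ → s) , (λ _ _ _ → t))
    (all? (λ i → i ∼? i)
      ×-dec all? (λ i → all? λ j → (i ∼? j) →-dec (j ∼? i))
      ×-dec all? (λ i → all? λ j → all? λ k →
              (i ∼? j) →-dec ((j ∼? k) →-dec (i ∼? k))))

  nonCrossing? : Dec (NonCrossing _∼_)
  nonCrossing? = map′
    (λ h {i} {j} {k} {l} → h i j k l)
    (λ h _ _ _ _ → h)
    (all? λ i → all? λ j → all? λ k → all? λ l →
      (i <? j) →-dec ((j <? k) →-dec ((k <? l) →-dec
        ((i ∼? k) →-dec ((j ∼? l) →-dec (i ∼? j))))))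

∼-isEquivalence : (π : NC n) → IsEquivalence (SameBlock π)
∼-isEquivalence π@(mkNC _ eq _) = recompute (isEquivalence? (SameBlock? π)) eq

∼-nonCrossing : (π : NC n) → NonCrossing (SameBlock π)
∼-nonCrossing π@(mkNC _ _ nc) = recompute (nonCrossing? (SameBlock? π)) nc

table-injective : {π σ : NC n} → table π ≡ table σ → π ≡ σ
table-injective refl = refl

infix 4 _≟_
_≟_ : Decidable {A = NC n} _≡_
π ≟ σ = map′ table-injective (cong table) (≡-dec (≡-dec Bool._≟_) (table π) (table σ))

module _ {_∼_ : Rel (Fin n) 0ℓ} (_∼?_ : Decidable _∼_) where

  private
    tab : Vec (Subset n) n
    tab = tabulate λ i → tabulate λ j → does (i ∼? j)

    lookup-tab : ∀ i j → lookup (lookup tab i) j ≡ does (i ∼? j)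
    lookup-tab i j = trans (cong (λ p → lookup p j) (lookup∘tabulate _ i)) (lookup∘tabulate _ j)

    ∈⁺ : ∀ {i j} → i ∼ j → j ∈ lookup tab i
    ∈⁺ {i} {j} i∼j = lookup⇒[]= j _ (trans (lookup-tab i j) (lemma (i ∼? j)))
      where
      lemma : (d : Dec (i ∼ j)) → does d ≡ true
      lemma (yes _)  = refl
      lemma (no i≁j) = contradiction i∼j i≁j

    ∈⁻ : ∀ {i j} → j ∈ lookup tab i → i ∼ j
    ∈⁻ {i} {j} j∈ = lemma (i ∼? j) (trans (sym (lookup-tab i j)) ([]=⇒lookup j∈))
      where
      lemma : (d : Dec (i ∼ j)) → does d ≡ true → i ∼ j
      lemma (yes i∼j) _ = i∼j

  classes : IsEquivalence _∼_ → NonCrossing _∼_ → NC n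
  classes eq nc = mkNC tab
    (record
      { refl  = ∈⁺ E.refl
      ; sym   = ∈⁺ ∘ E.sym ∘ ∈⁻
      ; trans = λ p q → ∈⁺ (E.trans (∈⁻ p) (∈⁻ q))
      })
    (λ i<j j<k k<l p q → ∈⁺ (nc i<j j<k k<l (∈⁻ p) (∈⁻ q)))
    where module E = IsEquivalence eq

  classes⁺ : ∀ {eq : IsEquivalence _∼_} {nc : NonCrossing _∼_} {i j} → i ∼ j → i ∼[ classes eq nc ] j
  classes⁺ = ∈⁺

  classes⁻ : ∀ {eq : IsEquivalence _∼_} {nc : NonCrossing _∼_} {i j} → i ∼[ classes eq nc ] j → i ∼ j
  classes⁻ = ∈⁻

-- Every non-crossing partition occurs exactly once: run over all tables,
-- keeping the lawful ones.

vectors : ∀ {a} {A : Set a} → List A → ∀ n → List (Vec A n)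
vectors xs zero    = [] ∷ []
vectors xs (suc n) = cartesianProductWith _∷_ xs (vectors xs n)

fromTable : Vec (Subset n) n → Maybe (NC n)
fromTable t with isEquivalence? (λ i j → j ∈? lookup t i) | nonCrossing? (λ i j → j ∈? lookup t i)
... | yes eq | yes nc = just (mkNC t eq nc)
... | _      | _      = nothing

allNC : ∀ n → List (NC n)
allNC n = mapMaybe fromTable (vectors (vectors (inside ∷ outside ∷ []) n) n)

IsLeast : NC n → Pred (Fin n) 0ℓ
IsLeast π i = ∀ j → i ∼[ π ] j → i ≤ j

isLeast? : (π : NC n) → Decidable₁ (IsLeast π)
isLeast? π i = all? λ j → SameBlock? π i j →-dec (i ≤? j)

-- Each block is listed once, through its least element.

leasts : NC n → List (Fin n)
leasts π = filter (isLeast? π) (allFin _)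

blocks : NC n → List (Subset n)
blocks π = List.map (block π) (leasts π)

private
  least : {P : Pred (Fin n) 0ℓ} → Decidable₁ P → ∀ {i} → P i →
          ∃[ k ] P k × (∀ j → P j → k ≤ j)
  least {suc n} P? {i} Pi with P? zero
  ... | yes P0 = zero , P0 , λ _ _ → z≤n
  least {suc n} P? {zero}  P0 | no ¬P0 = contradiction P0 ¬P0
  least {suc n} P? {suc i} Pi | no ¬P0 =
    let k , Pk , min = least (P? ∘ suc) Pi in
    suc k , Pk , λ { zero P0 → contradiction P0 ¬P0 ; (suc j) Pj → s≤s (min j Pj) }

  ∈-⋃⁺ : ∀ {x} {V : Subset n} {Vs} → V ∈ˡ Vs → x ∈ V → x ∈ ⋃ Vs
  ∈-⋃⁺ {Vs = _ ∷ Vs} (here refl) x∈V = p⊆p∪q (⋃ Vs) x∈V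
  ∈-⋃⁺ {Vs = V ∷ Vs} (there V∈)  x∈V = q⊆p∪q V (⋃ Vs) (∈-⋃⁺ V∈ x∈V)

  ∈-⋃⁻ : ∀ {x} (Vs : List (Subset n)) → x ∈ ⋃ Vs → ∃[ V ] V ∈ˡ Vs × x ∈ V
  ∈-⋃⁻ []       x∈ = contradiction x∈ ∉⊥
  ∈-⋃⁻ (V ∷ Vs) x∈ with x∈p∪q⁻ V (⋃ Vs) x∈
  ... | inj₁ x∈V = V , here refl , x∈V
  ... | inj₂ x∈′ = let V′ , V′∈ , x∈V′ = ∈-⋃⁻ Vs x∈′ in V′ , there V′∈ , x∈V′

block-cong : (π : NC n) {i j : Fin n} → i ∼[ π ] j → block π i ≡ block π j
block-cong π i∼j = ⊆-antisym (λ x∈ → E.trans (E.sym i∼j) x∈) (λ x∈ → E.trans i∼j x∈)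
  where module E = IsEquivalence (∼-isEquivalence π)

block-∈ : (π : NC n) (i : Fin n) → block π i ∈ˡ blocks π
block-∈ π i =
  let module E = IsEquivalence (∼-isEquivalence π)
      k , i∼k , min = least (SameBlock? π i) {i} E.refl
      k-least = λ j k∼j → min j (E.trans i∼k k∼j)
  in subst (_∈ˡ blocks π) (sym (block-cong π i∼k))
       (∈-map⁺ (block π) (∈-filter⁺ (isLeast? π) (∈-allFin k) k-least))

infix 4 _≼_ _≼?_

_≼_ : Rel (NC n) 0ℓ
π ≼ σ = ∀ {W} → W ∈ˡ blocks σ → ∃[ Vs ] All (_∈ˡ blocks π) Vs × W ≡ ⋃ Vs

≼⇒∼ : {π σ : NC n} → π ≼ σ → ∀ i j → i ∼[ π ] j → i ∼[ σ ] j
≼⇒∼ {π = π} {σ} π≼σ i j i∼j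
  with Vs , Vs⊆ , eq ← π≼σ (block-∈ σ i)
  with V , V∈ , i∈V ← ∈-⋃⁻ Vs (subst (i ∈_) eq (IsEquivalence.refl (∼-isEquivalence σ)))
  with k , _ , refl ← ∈-map⁻ (block π) (All.lookup Vs⊆ V∈)
  = subst (j ∈_) (sym eq) (∈-⋃⁺ V∈ (IsEquivalence.trans (∼-isEquivalence π) i∈V i∼j))

∼⇒≼ : {π σ : NC n} → (∀ i j → i ∼[ π ] j → i ∼[ σ ] j) → π ≼ σ
∼⇒≼ {n} {π} {σ} π⇒σ W∈ with k , _ , refl ← ∈-map⁻ (block σ) W∈
  = Vs , All.tabulate Vs⊆ , ⊆-antisym to from
  where
  W  = block σ k
  is = filter (_∈? W) (allFin n)
  Vs = List.map (block π) is

  Vs⊆ : ∀ {V} → V ∈ˡ Vs → V ∈ˡ blocks π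
  Vs⊆ V∈ with i , _ , refl ← ∈-map⁻ (block π) V∈ = block-∈ π i

  to : W ⊆ ⋃ Vs
  to {i} i∈W = ∈-⋃⁺ (∈-map⁺ (block π) (∈-filter⁺ (_∈? W) (∈-allFin i) i∈W))
                    (IsEquivalence.refl (∼-isEquivalence π))

  from : ⋃ Vs ⊆ W
  from {x} x∈ with V , V∈ , x∈V ← ∈-⋃⁻ Vs x∈
              with i , i∈ , refl ← ∈-map⁻ (block π) V∈
    = IsEquivalence.trans (∼-isEquivalence σ)
        (proj₂ (∈-filter⁻ (_∈? W) {xs = allFin n} i∈)) (π⇒σ i x x∈V)

_≼?_ : Decidable (_≼_ {n})
π ≼? σ = map′ (∼⇒≼ {π = π} {σ}) (≼⇒∼ {π = π} {σ})
  (all? λ i → all? λ j → SameBlock? π i j →-dec SameBlock? σ i j)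

≼-refl : (π : NC n) → π ≼ π
≼-refl π = ∼⇒≼ {π = π} {π} (λ _ _ → id)

𝟙 : NC n
𝟙 = classes {_∼_ = λ _ _ → ⊤} (λ _ _ → yes tt)
  (record { refl = _ ; sym = _ ; trans = _ })
  (λ _ _ _ _ _ → tt)

≼-𝟙 : (π : NC n) → π ≼ 𝟙
≼-𝟙 π = ∼⇒≼ {π = π} {𝟙} (λ _ _ _ → classes⁺ (λ _ _ → yes tt) tt)

-- The increasing enumeration p₁ < ⋯ < pₘ of the elements of a subset.

enum : (W : Subset n) → Fin ∣ W ∣ → Fin n
enum (inside  ∷ W) zero    = zero
enum (inside  ∷ W) (suc k) = suc (enum W k)
enum (outside ∷ W) k       = suc (enum W k)

enum-mono-< : (W : Subset n) {i j : Fin ∣ W ∣} → i < j → enum W i < enum W j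
enum-mono-< (inside  ∷ W) {zero}  {suc j} _   = z<s
enum-mono-< (inside  ∷ W) {suc i} {suc j} i<j = s<s (enum-mono-< W (s<s⁻¹ i<j))
enum-mono-< (outside ∷ W)                 i<j = s<s (enum-mono-< W i<j)

infixl 6 _↾_
_↾_ : NC n → (W : Subset n) → NC ∣ W ∣
π ↾ W = classes {_∼_ = SameBlock π on enum W}
  (λ i j → SameBlock? π (enum W i) (enum W j))
  (On.isEquivalence (enum W) (∼-isEquivalence π))
  (λ i<j j<k k<l →
    ∼-nonCrossing π (enum-mono-< W i<j) (enum-mono-< W j<k) (enum-mono-< W k<l))

-- splitAt m sends the first m points to the left summand, the remaining n
-- points to the right one.

splitAt-mono-< : ∀ m {n} {i j : Fin (m + n)} → i < j → (_<_ ⊎-< _<_) (splitAt m i) (splitAt m j)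
splitAt-mono-< zero                          i<j = ₂∼₂ i<j
splitAt-mono-< (suc m) {i = zero}  {suc j} _   with splitAt m j
... | inj₁ _ = ₁∼₁ z<s
... | inj₂ _ = ₁∼₂
splitAt-mono-< (suc m) {i = suc i} {suc j} i<j
  with splitAt m i | splitAt m j | splitAt-mono-< m (s<s⁻¹ i<j)
... | inj₁ _ | inj₁ _ | ₁∼₁ p = ₁∼₁ (s<s p)
... | inj₁ _ | inj₂ _ | ₁∼₂   = ₁∼₂
... | inj₂ _ | inj₂ _ | ₂∼₂ p = ₂∼₂ p

infixr 5 _◇_
_◇_ : NC m → NC n → NC (m + n)
_◇_ {m} {n} π₁ π₂ = classes {_∼_ = _∼_ on splitAt m}
  (λ i j → ⊎-decidable (SameBlock? π₁) (SameBlock? π₂) (splitAt m i) (splitAt m j))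
  (On.isEquivalence (splitAt m) eq)
  (λ {i} {j} {k} {l} i<j j<k k<l →
    nc {splitAt m i} {splitAt m j} {splitAt m k} {splitAt m l}
      (splitAt-mono-< m i<j) (splitAt-mono-< m j<k) (splitAt-mono-< m k<l))
  where
  module E₁ = IsEquivalence (∼-isEquivalence π₁)
  module E₂ = IsEquivalence (∼-isEquivalence π₂)

  _∼_ : Rel (Fin m ⊎ Fin n) 0ℓ
  _∼_ = Pointwise (SameBlock π₁) (SameBlock π₂)

  eq : IsEquivalence _∼_
  eq = record
    { refl  = ⊎-refl E₁.refl E₂.refl
    ; sym   = ⊎-symmetric E₁.sym E₂.sym
    ; trans = ⊎-transitive E₁.trans E₂.trans
    }

  _⊏_ : Rel (Fin m ⊎ Fin n) 0ℓ
  _⊏_ = _<_ ⊎-< _<_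

  nc : ∀ {i j k l} → i ⊏ j → j ⊏ k → k ⊏ l → i ∼ k → j ∼ l → i ∼ j
  nc (₁∼₁ p) (₁∼₁ q) (₁∼₁ r) (inj₁ a) (inj₁ b) = inj₁ (∼-nonCrossing π₁ p q r a b)
  nc (₂∼₂ p) (₂∼₂ q) (₂∼₂ r) (inj₂ a) (inj₂ b) = inj₂ (∼-nonCrossing π₂ p q r a b)

record NC² : Set where
  constructor pair
  field
    {size}         : ℕ
    .{{nonZero}}   : NonZero size
    lower          : NC size
    upper          : NC size
    .lower≼upper   : lower ≼ upper

infix 6 ⟨_,𝟙⟩
⟨_,𝟙⟩ : .{{NonZero n}} → NC n → NC²
⟨ π ,𝟙⟩ = pair π 𝟙 (≼-𝟙 π)

m+n≢0 : ∀ m {n} → .{{NonZero m}} → NonZero (m + n)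
m+n≢0 (suc m) = _

∈⇒∣W∣≢0 : {W : Subset n} {i : Fin n} → i ∈ W → NonZero ∣ W ∣
∈⇒∣W∣≢0 here                            = _
∈⇒∣W∣≢0 {W = inside  ∷ _} (there _)  = _
∈⇒∣W∣≢0 {W = outside ∷ _} (there i∈) = ∈⇒∣W∣≢0 i∈

∣block∣≢0 : (π : NC n) (i : Fin n) → NonZero ∣ block π i ∣
∣block∣≢0 π i = ∈⇒∣W∣≢0 (IsEquivalence.refl (∼-isEquivalence π) {i})

module Functions {c ℓ} (R : CommutativeRing c ℓ) where

  open CommutativeRing R
    using (Carrier; _≈_; 0#; 1#) renaming (_+_ to _⊕_; _*_ to _⊗_)

  ∑ ∏ : List Carrier → Carrier
  ∑ = foldr _⊕_ 0#
  ∏ = foldr _⊗_ 1#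

  Fun : Set c
  Fun = NC² → Carrier

  infix 4 _≐_
  _≐_ : Fun → Fun → Set ℓ
  f ≐ g = ∀ x → f x ≈ g x

  term : Fun → Fun → ∀ {n} → .{{NonZero n}} → (π σ ρ : NC n) → Carrier
  term f g π σ ρ with π ≼? ρ | ρ ≼? σ
  ... | yes π≼ρ | yes ρ≼σ = f (pair π ρ π≼ρ) ⊗ g (pair ρ σ ρ≼σ)
  ... | _       | _       = 0#

  infixl 7 _⋆_
  _⋆_ : Fun → Fun → Fun
  (f ⋆ g) (pair {n} π σ _) = ∑ (List.map (term f g π σ) (allNC n))

  e : Fun
  e (pair π σ _) = if does (π ≟ σ) then 1# else 0#

  -- The product over W ∈ σ runs over the least elements i of the blocks
  -- W = block σ i.

  record 𝒢 (g : Fun) : Set ℓ where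
    field
      unital : ∀ {n} .{{_ : NonZero n}} (π : NC n) → g (pair π π (≼-refl π)) ≈ 1#
      multiplicative : ∀ {n} .{{_ : NonZero n}} (π σ : NC n) (π≼σ : π ≼ σ) →
        g (pair π σ π≼σ) ≈
        ∏ (List.map (λ i → g (⟨_,𝟙⟩ {{∣block∣≢0 σ i}} (π ↾ block σ i))) (leasts σ))

  record 𝒢-cc (g : Fun) : Set ℓ where
    field
      ∈𝒢 : 𝒢 g
      vanishes-◇ : ∀ {m n} .{{_ : NonZero m}} .{{_ : NonZero n}} (π₁ : NC m) (π₂ : NC n) →
        g (⟨_,𝟙⟩ {{m+n≢0 m}} (π₁ ◇ π₂)) ≈ 0#

  IsInverse : Fun → Fun → Set ℓ
  IsInverse g h = (g ⋆ h ≐ e) × (h ⋆ g ≐ e)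

{-# OPTIONS --safe #-}
-- A multiplicative g factorises over every interval [π,σ]: restricting
-- partitions to the blocks W of σ identifies {ρ ≤ σ} with ∏ NC(|W|), and
-- g(π,ρ) = ∏ g(π_W,ρ_W). Hence (g * f)(π,σ) = ∏ (g * f)(π_W,1) for
-- multiplicative f, which gives closure under convolution and, by uniqueness
-- of inverses, multiplicativity of g⁻¹.
--
-- A concatenation is a partition none of whose blocks straddles some cut of
-- the points. If π respects a cut and π ≤ ρ, then either ρ respects it too, so
-- that g₂(ρ,1) = 0, or a block W of ρ straddles it, so that π_W respects a cut
-- of W and the factor g₁(π_W,1) of g₁(π,ρ) vanishes. Every term of
-- (g₁ * g₂)(π,1) is therefore zero, and the same dichotomy, applied to the
-- partial sums of the Neumann series of e - g, handles g⁻¹.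
module Submission where

open import Defs
open import Algebra.Bundles using (CommutativeMonoid; CommutativeRing)
import Algebra.Properties.Ring as RingProperties
import Algebra.Properties.CommutativeSemigroup as CommutativeSemigroupProperties
open import Data.Bool.Base using (Bool; true; false; if_then_else_)
import Data.Bool.Properties as Bool
open import Data.Empty using (⊥)
open import Data.Fin.Base as Fin using (Fin; zero; suc; _<_; toℕ; inject₁; splitAt)
open import Data.Fin.Properties as Fin using (toℕ-injective; injective⇒≤; any?)
open import Data.Fin.Subset using (Subset; inside; outside; _∈_; _⊆_; ∣_∣)
open import Data.Fin.Subset.Properties using (⊆-antisym; p⊆q⇒∣p∣≤∣q∣; p⊂q⇒∣p∣<∣q∣; ∣p∣≤n; _∈?_)
open import Data.List.Base as List
  using (List; []; _∷_; _++_; allFin; cartesianProductWith; concatMap; filter; foldr; mapMaybe)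
open import Data.List.Membership.Propositional renaming (_∈_ to _∈ˡ_)
open import Data.List.Membership.Propositional.Properties
  using (∈-map⁺; ∈-map⁻; ∈-filter⁺; ∈-filter⁻; ∈-allFin; ∈-cartesianProductWith⁺; ∈-concatMap⁺; ∈-concatMap⁻)
open import Data.List.Membership.Propositional.Properties.WithK using (unique∧set⇒bag; unique⇒irrelevant)
open import Data.List.Properties using (map-∘)
open import Data.List.Relation.Binary.BagAndSetEquality using (∼bag⇒↭)
open import Data.List.Relation.Binary.Permutation.Propositional as Perm using (_↭_)
open import Data.List.Relation.Unary.All as All using (All; []; _∷_)
import Data.List.Relation.Unary.All.Properties as All
open import Data.List.Relation.Unary.AllPairs using ([]; _∷_)
open import Data.List.Relation.Unary.Any as Any using (here; there)
import Data.List.Relation.Unary.Any.Properties as Any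
open import Data.List.Relation.Unary.Unique.Propositional using (Unique)
import Data.List.Relation.Unary.Unique.Propositional.Properties as Unique
open import Data.Maybe.Base using (Maybe; just; nothing)
open import Data.Maybe.Relation.Unary.All as MAll using (just; nothing)
open import Data.Maybe.Relation.Unary.Any as MAny using (just)
open import Data.Nat.Base as ℕ using (ℕ; zero; suc; NonZero; z≤n; s≤s)
open import Data.Nat.ListAction using () renaming (sum to sumℕ)
import Data.Nat.Properties as ℕ
open import Data.Product using (_×_; _,_; ∃-syntax; proj₁; proj₂)
open import Data.Sum.Base using (_⊎_; inj₁; inj₂; [_,_]′)
open import Data.Sum.Relation.Binary.LeftOrder using (_⊎-<_; ₁∼₁; ₂∼₂)
open import Data.Sum.Relation.Binary.Pointwise using (Pointwise; inj₁; inj₂; ⊎-decidable; ⊎-isEquivalence)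
open import Data.Unit.Base using (tt)
open import Data.Vec.Base as Vec using (Vec; []; _∷_; here; there; lookup)
open import Data.Vec.Properties using (tabulate∘lookup; tabulate-cong)
open import Function.Base using (_∘_; _on_; const; id)
open import Function.Bundles using (mk⇔)
open import Level using (0ℓ)
open import Relation.Binary.Definitions using (tri<; tri≈; tri>)
open import Relation.Binary.PropositionalEquality as ≡
  using (_≡_; _≢_; refl; sym; trans; cong; subst)
import Relation.Binary.Construct.On as On
open import Relation.Binary.Structures using (IsEquivalence)
import Relation.Binary.Reasoning.Setoid as SetoidReasoning
open import Relation.Nullary.Decidable
  using (Dec; yes; no; dec-true; dec-false; map′; recompute; decidable-stable; ¬?; _×-dec_; _⊎-dec_)
open import Relation.Nullary.Negation using (¬_; contradiction)
open import Relation.Unary using (Pred; Decidable)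

-- The two properties of `g⁻¹` are reached by different routes. Vanishing at a cut is a linear
-- condition, so it can be carried through the partial sums by induction. Multiplicativity is not
-- linear and the partial sums need not be multiplicative, which is why uniqueness of inverses is
-- called on. No division occurs: `g (π , π)` is 1, so `e - g` is nilpotent on each `NC(n)`, and any
-- commutative ring can stand for the complex numbers. Cuts are predicates because a predicate
-- restricts to a block by composition with the block's enumeration, whereas the two sizes of a
-- concatenation would have to be recomputed.

private
  variable
    m n : ℕ
    A B : Set
    x y : A
    xs ys : List A

module _ {c ℓ} (R : CommutativeRing c ℓ) where

  open Functions R
  open CommutativeRing R using (Carrier; 0#; _*_)

  data TermView .{{_ : NonZero n}} (f g : Fun) (π σ ρ : NC n) : Carrier → Set c where
    between   : .(π≼ρ : π ≼ ρ) .(ρ≼σ : ρ ≼ σ) → TermView f g π σ ρ (f (pair π ρ π≼ρ) * g (pair ρ σ ρ≼σ))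
    elsewhere : (π ≼ ρ → ρ ≼ σ → ⊥) → TermView f g π σ ρ 0#

  -- The normal form of π ≼? ρ is huge; this is the only case analysis on it.
  termView : .{{_ : NonZero n}} (f g : Fun) (π σ ρ : NC n) → TermView f g π σ ρ (term f g π σ ρ)
  termView f g π σ ρ with π ≼? ρ | ρ ≼? σ
  ... | yes π≼ρ | yes ρ≼σ = between π≼ρ ρ≼σ
  ... | yes _   | no ρ⋠σ  = elsewhere λ _ ρ≼σ → ρ⋠σ ρ≼σ
  ... | no π⋠ρ  | _       = elsewhere λ π≼ρ _ → π⋠ρ π≼ρ

-- Lists without repetitions

-- Without repetitions every membership proof is unique, so equal sets of elements are equal
-- multisets. Both permutations that reindex sums and products below come from here.
unique-↭ : Unique xs → Unique ys → (∀ {x} → x ∈ˡ xs → x ∈ˡ ys) → (∀ {x} → x ∈ˡ ys → x ∈ˡ xs) → xs ↭ ys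
unique-↭ xs! ys! to from = ∼bag⇒↭ (unique∧set⇒bag xs! ys! (mk⇔ to from))

mapMaybe-unique : (f : A → Maybe B) → (∀ {x y z} → f x ≡ just z → f y ≡ just z → x ≡ y) →
                  Unique xs → Unique (mapMaybe f xs)
mapMaybe-unique f inj []  = []
mapMaybe-unique {xs = x ∷ xs} f inj (x∉ ∷ xs!) with f x in fx
... | nothing = mapMaybe-unique f inj xs!
... | just z  = All.mapMaybe⁺ (All.map⁺ (All.map distinct x∉)) ∷ mapMaybe-unique f inj xs!
  where
  distinct : ∀ {y} → x ≢ y → MAll.All (z ≢_) (f y)
  distinct {y} x≢y with f y in fy
  ... | nothing = nothing
  ... | just w  = just λ { refl → x≢y (inj fx fy) }

∈-mapMaybe⁺ : (f : A → Maybe B) {z : B} → x ∈ˡ xs → f x ≡ just z → z ∈ˡ mapMaybe f xs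
∈-mapMaybe⁺ {xs = xs} f x∈ fx = Any.mapMaybe⁺ f xs
  (Any.map⁺ (Any.map (λ { refl → subst (MAny.Any _) (sym fx) (just refl) }) x∈))

concatMap-unique : (f : A → List B) → Unique xs → (∀ x → Unique (f x)) →
                   (∀ {x y z} → x ∈ˡ xs → y ∈ˡ xs → z ∈ˡ f x → z ∈ˡ f y → x ≡ y) →
                   Unique (concatMap f xs)
concatMap-unique f []         f! disjoint = []
concatMap-unique {xs = x ∷ xs} f (x∉ ∷ xs!) f! disjoint =
  Unique.++⁺ (f! x) (concatMap-unique f xs! f! λ p q → disjoint (there p) (there q)) separate
  where
  separate : ∀ {z} → ¬ (z ∈ˡ f x × z ∈ˡ concatMap f xs)
  separate (z∈ , z∈′) with y , y∈ , z∈fy ← find (∈-concatMap⁻ f z∈′) =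
    All.lookup x∉ y∈ (disjoint (here refl) (there y∈) z∈ z∈fy)

All-ext : ∀ {P : A → Set} {ps qs : All P xs} →
          (∀ {x} (x∈ : x ∈ˡ xs) → All.lookup ps x∈ ≡ All.lookup qs x∈) → ps ≡ qs
All-ext {ps = []}     {[]}     eq = refl
All-ext {ps = p ∷ ps} {q ∷ qs} eq = ≡.cong₂ _∷_ (eq (here refl)) (All-ext (eq ∘ there))

vectors-unique : Unique xs → ∀ n → Unique (vectors xs n)
vectors-unique xs! zero    = [] ∷ []
vectors-unique xs! (suc n) = Unique.cartesianProductWith⁺ _∷_ (λ { refl → refl , refl }) xs! (vectors-unique xs! n)

vectors-complete : (∀ x → x ∈ˡ xs) → (v : Vec A n) → v ∈ˡ vectors xs n
vectors-complete all []      = here refl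
vectors-complete all (x ∷ v) = ∈-cartesianProductWith⁺ _∷_ (all x) (vectors-complete all v)

-- Folds over a commutative monoid, instantiated at sums and at products

module Fold {c ℓ} (M : CommutativeMonoid c ℓ) where

  open CommutativeMonoid M renaming (refl to ≈-refl; sym to ≈-sym; trans to ≈-trans)
  open CommutativeSemigroupProperties commutativeSemigroup using (interchange; x∙yz≈y∙xz)

  fold : (A → Carrier) → List A → Carrier
  fold F xs = foldr _∙_ ε (List.map F xs)

  private
    variable
      F G : A → Carrier

  fold-cong : (∀ {x} → x ∈ˡ xs → F x ≈ G x) → fold F xs ≈ fold G xs
  fold-cong {xs = []}     F≈G = ≈-refl
  fold-cong {xs = x ∷ xs} F≈G = ∙-cong (F≈G (here refl)) (fold-cong (F≈G ∘ there))

  fold-ε : (∀ {x} → x ∈ˡ xs → F x ≈ ε) → fold F xs ≈ ε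
  fold-ε {xs = []}     F≈ε = ≈-refl
  fold-ε {xs = x ∷ xs} F≈ε = ≈-trans (∙-cong (F≈ε (here refl)) (fold-ε (F≈ε ∘ there))) (identityˡ ε)

  fold-∙ : (xs : List A) → fold (λ x → F x ∙ G x) xs ≈ fold F xs ∙ fold G xs
  fold-∙ []       = ≈-sym (identityˡ ε)
  fold-∙ (x ∷ xs) = ≈-trans (∙-congˡ (fold-∙ xs)) (interchange _ _ _ _)

  fold-swap : (F : A → B → Carrier) (xs : List A) (ys : List B) →
              fold (λ x → fold (F x) ys) xs ≈ fold (λ y → fold (λ x → F x y) xs) ys
  fold-swap F []       ys = ≈-sym (fold-ε {xs = ys} λ _ → ≈-refl)
  fold-swap F (x ∷ xs) ys = ≈-trans (∙-congˡ (fold-swap F xs ys)) (≈-sym (fold-∙ {F = F x} ys))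

  fold-++ : (xs ys : List A) → fold F (xs ++ ys) ≈ fold F xs ∙ fold F ys
  fold-++ []       ys = ≈-sym (identityˡ _)
  fold-++ (x ∷ xs) ys = ≈-trans (∙-congˡ (fold-++ xs ys)) (≈-sym (assoc _ _ _))

  fold-concatMap : (f : A → List B) (xs : List A) → fold F (concatMap f xs) ≈ fold (fold F ∘ f) xs
  fold-concatMap f []       = ≈-refl
  fold-concatMap f (x ∷ xs) = ≈-trans (fold-++ (f x) (concatMap f xs)) (∙-congˡ (fold-concatMap f xs))

  fold-map : (f : A → B) (xs : List A) → fold F (List.map f xs) ≈ fold (F ∘ f) xs
  fold-map f xs = reflexive (cong (foldr _∙_ ε) (sym (map-∘ xs)))

  fold-↭ : xs ↭ ys → fold F xs ≈ fold F ys
  fold-↭ Perm.refl         = ≈-refl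
  fold-↭ (Perm.prep x p)   = ∙-congˡ (fold-↭ p)
  fold-↭ (Perm.swap x y p) = ≈-trans (∙-congˡ (∙-congˡ (fold-↭ p))) (x∙yz≈y∙xz _ _ _)
  fold-↭ (Perm.trans p q)  = ≈-trans (fold-↭ p) (fold-↭ q)

  fold-single : Unique xs → y ∈ˡ xs → (∀ {x} → x ∈ˡ xs → x ≢ y → F x ≈ ε) → fold F xs ≈ F y
  fold-single (y∉ ∷ xs!) (here refl) F≈ε =
    ≈-trans (∙-congˡ (fold-ε λ x∈ → F≈ε (there x∈) λ { refl → All.lookup y∉ x∈ refl })) (identityʳ _)
  fold-single (x∉ ∷ xs!) (there y∈)  F≈ε =
    ≈-trans (∙-cong (F≈ε (here refl) (All.lookup x∉ y∈)) (fold-single xs! y∈ (F≈ε ∘ there))) (identityˡ _)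

  fold-filter : {P : Pred A 0ℓ} (P? : Decidable P) (xs : List A) → (∀ {x} → ¬ P x → F x ≈ ε) →
                fold F xs ≈ fold F (filter P? xs)
  fold-filter P? []       F≈ε = ≈-refl
  fold-filter P? (x ∷ xs) F≈ε with P? x
  ... | yes _  = ∙-congˡ (fold-filter P? xs F≈ε)
  ... | no ¬Px = ≈-trans (∙-cong (F≈ε ¬Px) (fold-filter P? xs F≈ε)) (identityˡ _)

-- Non-crossing partitions

module _ (π : NC n) where
  open IsEquivalence (∼-isEquivalence π) public using ()
    renaming (refl to ∼-refl; sym to ∼-sym; trans to ∼-trans)

NC-ext : {π ρ : NC n} → (∀ {i j} → i ∼[ π ] j → i ∼[ ρ ] j) → (∀ {i j} → i ∼[ ρ ] j → i ∼[ π ] j) → π ≡ ρ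
NC-ext {π = π} {ρ} π⇒ρ ρ⇒π = table-injective (begin
  table π                ≡⟨ tabulate∘lookup (table π) ⟨
  Vec.tabulate (block π) ≡⟨ tabulate-cong (λ i → ⊆-antisym π⇒ρ ρ⇒π) ⟩
  Vec.tabulate (block ρ) ≡⟨ tabulate∘lookup (table ρ) ⟩
  table ρ                ∎)
  where open ≡.≡-Reasoning

-- A record, because neither partition can be inferred from the function
-- type π ≼ ρ.

infix 4 _⊑_ _⊑?_

record _⊑_ (π ρ : NC n) : Set where
  constructor coarser
  field
    coarsen : ∀ {i j} → i ∼[ π ] j → i ∼[ ρ ] j

open _⊑_ public

⊑⇒≼ : {π ρ : NC n} → π ⊑ ρ → π ≼ ρ
⊑⇒≼ {π = π} {ρ} π⊑ρ = ∼⇒≼ {π = π} {ρ} λ _ _ → coarsen π⊑ρ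

≼⇒⊑ : {π ρ : NC n} → π ≼ ρ → π ⊑ ρ
≼⇒⊑ {π = π} {ρ} π≼ρ = coarser λ {i} {j} → ≼⇒∼ {π = π} {ρ} π≼ρ i j

opaque
  -- Opaque, so that case distinctions never unfold the nested finite searches inside `_≼?_`.
  _⊑?_ : (π ρ : NC n) → Dec (π ⊑ ρ)
  π ⊑? ρ = map′ (≼⇒⊑ {π = π} {ρ}) ⊑⇒≼ (π ≼? ρ)

-- `NC²` keeps its order proof irrelevant; decidability makes it relevant again.
recompute-⊑ : {π ρ : NC n} → .(π ≼ ρ) → π ⊑ ρ
recompute-⊑ {π = π} {ρ} π≼ρ = recompute (π ⊑? ρ) (≼⇒⊑ {π = π} {ρ} π≼ρ)

⊑-refl : (π : NC n) → π ⊑ π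
⊑-refl π = coarser id

⊑-trans : {π ρ σ : NC n} → π ⊑ ρ → ρ ⊑ σ → π ⊑ σ
⊑-trans π⊑ρ ρ⊑σ = coarser (coarsen ρ⊑σ ∘ coarsen π⊑ρ)

⊑-antisym : {π ρ : NC n} → π ⊑ ρ → ρ ⊑ π → π ≡ ρ
⊑-antisym π⊑ρ ρ⊑π = NC-ext (coarsen π⊑ρ) (coarsen ρ⊑π)

fromTable-injective : {t u : Vec (Subset n) n} {π : NC n} → fromTable t ≡ just π → fromTable u ≡ just π → t ≡ u
fromTable-injective p q = trans (sym (table-fromTable p)) (table-fromTable q)
  where
  table-fromTable : {t : Vec (Subset n) n} {π : NC n} → fromTable t ≡ just π → table π ≡ t
  table-fromTable {t = t} eq
    with isEquivalence? (λ i j → j ∈? lookup t i)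
       | nonCrossing? (λ i j → j ∈? lookup t i)
  table-fromTable refl | yes _ | yes _ = refl

fromTable-table : (π : NC n) → fromTable (table π) ≡ just π
fromTable-table π with isEquivalence? (SameBlock? π) | nonCrossing? (SameBlock? π)
... | yes _  | yes _  = refl
... | yes _  | no ¬nc = contradiction (λ {i} {j} {k} {l} → ∼-nonCrossing π {i} {j} {k} {l}) ¬nc
... | no ¬eq | _      = contradiction (∼-isEquivalence π) ¬eq

allNC-unique : ∀ n → Unique (allNC n)
allNC-unique n = mapMaybe-unique fromTable fromTable-injective
  (vectors-unique (vectors-unique (((λ ()) ∷ []) ∷ [] ∷ []) n) n)

allNC-complete : (π : NC n) → π ∈ˡ allNC n
allNC-complete {n} π = ∈-mapMaybe⁺ fromTable
  (vectors-complete (vectors-complete λ { true → here refl ; false → there (here refl) }) (table π))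
  (fromTable-table π)

𝟙-∼ : (i j : Fin n) → i ∼[ 𝟙 ] j
𝟙-∼ _ _ = classes⁺ (λ _ _ → yes tt) tt

⊑-𝟙 : (π : NC n) → π ⊑ 𝟙
⊑-𝟙 π = coarser λ _ → 𝟙-∼ _ _

-- Enumerating a subset and restricting partitions to it

enum-∈ : (W : Subset n) (a : Fin ∣ W ∣) → enum W a ∈ W
enum-∈ (inside  ∷ W) zero    = here
enum-∈ (inside  ∷ W) (suc a) = there (enum-∈ W a)
enum-∈ (outside ∷ W) a       = there (enum-∈ W a)

index : {W : Subset n} {x : Fin n} → x ∈ W → Fin ∣ W ∣
index here                           = zero
index {W = inside  ∷ _} (there x∈) = suc (index x∈)
index {W = outside ∷ _} (there x∈) = index x∈

enum-index : {W : Subset n} {x : Fin n} (x∈ : x ∈ W) → enum W (index x∈) ≡ x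
enum-index here                           = refl
enum-index {W = inside  ∷ _} (there x∈) = cong suc (enum-index x∈)
enum-index {W = outside ∷ _} (there x∈) = cong suc (enum-index x∈)

enum-surjective : {W : Subset n} {x : Fin n} → x ∈ W → ∃[ a ] enum W a ≡ x
enum-surjective x∈ = index x∈ , enum-index x∈

enum-cancel-< : (W : Subset n) {a b : Fin ∣ W ∣} → enum W a < enum W b → a < b
enum-cancel-< W {a} {b} p with Fin.<-cmp a b
... | tri< a<b _ _    = a<b
... | tri≈ _ refl _   = contradiction p (ℕ.<-irrefl refl)
... | tri> _ _ b<a    = contradiction p (ℕ.<-asym (enum-mono-< W b<a))

enum-injective : (W : Subset n) {a b : Fin ∣ W ∣} → enum W a ≡ enum W b → a ≡ b
enum-injective W {a} {b} eq with Fin.<-cmp a b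
... | tri< a<b _ _    = contradiction (cong toℕ eq) (ℕ.<⇒≢ (enum-mono-< W a<b))
... | tri≈ _ a≡b _    = a≡b
... | tri> _ _ b<a    = contradiction (cong toℕ (sym eq)) (ℕ.<⇒≢ (enum-mono-< W b<a))

module _ (π : NC n) (W : Subset n) where

  private
    equivalence : IsEquivalence (SameBlock π on enum W)
    equivalence = On.isEquivalence (enum W) (∼-isEquivalence π)

    noncrossing : NonCrossing (SameBlock π on enum W)
    noncrossing i<j j<k k<l = ∼-nonCrossing π (enum-mono-< W i<j) (enum-mono-< W j<k) (enum-mono-< W k<l)

  ↾⁺ : {a b : Fin ∣ W ∣} → enum W a ∼[ π ] enum W b → a ∼[ π ↾ W ] b
  ↾⁺ = classes⁺ (λ i j → SameBlock? π (enum W i) (enum W j)) {equivalence} {noncrossing}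

  ↾⁻ : {a b : Fin ∣ W ∣} → a ∼[ π ↾ W ] b → enum W a ∼[ π ] enum W b
  ↾⁻ = classes⁻ (λ i j → SameBlock? π (enum W i) (enum W j)) {equivalence} {noncrossing}

increasing⇒inflationary : (f : Fin m → Fin n) → (∀ {i j} → i < j → f i < f j) → ∀ i → i Fin.≤ f i
increasing⇒inflationary f f-mono zero    = z≤n
increasing⇒inflationary f f-mono (suc i) = ℕ.≤-<-trans
  -- Precomposing with `suc` would bound `f (suc i)` only by `i`. With `inject₁` the bound sits at
  -- the preceding point, and strictness supplies the missing unit.
  (increasing⇒inflationary (f ∘ inject₁) (λ {j} {k} j<k → f-mono
    (≡.subst₂ ℕ._<_ (sym (Fin.toℕ-inject₁ j)) (sym (Fin.toℕ-inject₁ k)) j<k)) i)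
  (f-mono (s≤s (ℕ.≤-reflexive (Fin.toℕ-inject₁ i))))

record OrderIso (m n : ℕ) : Set where
  field
    to        : Fin m → Fin n
    from      : Fin n → Fin m
    to-mono   : ∀ {i j} → i < j → to i < to j
    from-mono : ∀ {i j} → i < j → from i < from j
    to∘from   : ∀ i → to (from i) ≡ i
    from∘to   : ∀ i → from (to i) ≡ i

  size-≡ : m ≡ n
  size-≡ = ℕ.≤-antisym
    (injective⇒≤ {f = to} λ {i} {j} eq → trans (sym (from∘to i)) (trans (cong from eq) (from∘to j)))
    (injective⇒≤ {f = from} λ {i} {j} eq → trans (sym (to∘from i)) (trans (cong to eq) (to∘from j)))

  -- Finite chains are rigid: `to` and `from` are both inflationary and mutually inverse, so no
  -- point can move.
  toℕ-to : ∀ i → toℕ (to i) ≡ toℕ i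
  toℕ-to i = ℕ.≤-antisym
    (subst (to i Fin.≤_) (from∘to i) (increasing⇒inflationary from from-mono (to i)))
    (increasing⇒inflationary to to-mono i)

-- An equality in NC² compares partitions whose numbers of points are only
-- propositionally equal.

⟨,𝟙⟩-iso : .{{_ : NonZero m}} .{{_ : NonZero n}} (π : NC m) (ρ : NC n) (φ : OrderIso m n) →
  (∀ {a b} → a ∼[ π ] b → OrderIso.to φ a ∼[ ρ ] OrderIso.to φ b) →
  (∀ {a b} → OrderIso.to φ a ∼[ ρ ] OrderIso.to φ b → a ∼[ π ] b) →
  ⟨ π ,𝟙⟩ ≡ ⟨ ρ ,𝟙⟩
⟨,𝟙⟩-iso π ρ φ π⇒ρ ρ⇒π with refl ← OrderIso.size-≡ φ = cong (λ π → ⟨ π ,𝟙⟩) (NC-ext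
  (λ {a} {b} a∼b → ≡.subst₂ (SameBlock ρ) (to≡ a) (to≡ b) (π⇒ρ a∼b))
  (λ {a} {b} a∼b → ρ⇒π (≡.subst₂ (SameBlock ρ) (sym (to≡ a)) (sym (to≡ b)) a∼b)))
  where
  to≡ : ∀ i → OrderIso.to φ i ≡ i
  to≡ i = toℕ-injective (OrderIso.toℕ-to φ i)

enum-mono-≤ : (W : Subset n) {a b : Fin ∣ W ∣} → a Fin.≤ b → enum W a Fin.≤ enum W b
enum-mono-≤ W a≤b = ℕ.≮⇒≥ λ p → ℕ.<⇒≱ (enum-cancel-< W p) a≤b

enum-cancel-≤ : (W : Subset n) {a b : Fin ∣ W ∣} → enum W a Fin.≤ enum W b → a Fin.≤ b
enum-cancel-≤ W p = ℕ.≮⇒≥ λ b<a → ℕ.<⇒≱ (enum-mono-< W b<a) p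

↾-mono-⊑ : {π ρ : NC n} → π ⊑ ρ → (W : Subset n) → π ↾ W ⊑ ρ ↾ W
↾-mono-⊑ {π = π} {ρ} π⊑ρ W = coarser (↾⁺ ρ W ∘ coarsen π⊑ρ ∘ ↾⁻ π W)

module _ (π : NC n) (W : Subset n) (V : Subset ∣ W ∣) (U : Subset n)
         (V⊆U : ∀ {v} → v ∈ V → enum W v ∈ U) (U⊆V : ∀ {x} → x ∈ U → ∃[ v ] v ∈ V × enum W v ≡ x) where

  private
    to : Fin ∣ V ∣ → Fin ∣ U ∣
    to a = index (V⊆U (enum-∈ V a))

    enum-to : ∀ a → enum U (to a) ≡ enum W (enum V a)
    enum-to a = enum-index (V⊆U (enum-∈ V a))

    from : Fin ∣ U ∣ → Fin ∣ V ∣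
    from b = index (proj₁ (proj₂ (U⊆V (enum-∈ U b))))

    enum-from : ∀ b → enum W (enum V (from b)) ≡ enum U b
    enum-from b = let _ , v∈V , eq = U⊆V (enum-∈ U b) in trans (cong (enum W) (enum-index v∈V)) eq

    iso : OrderIso ∣ V ∣ ∣ U ∣
    iso = record
      { to        = to
      ; from      = from
      ; to-mono   = λ {i} {j} i<j → enum-cancel-< U (≡.subst₂ _<_ (sym (enum-to i)) (sym (enum-to j))
                      (enum-mono-< W (enum-mono-< V i<j)))
      ; from-mono = λ {i} {j} i<j → enum-cancel-< V (enum-cancel-< W
                      (≡.subst₂ _<_ (sym (enum-from i)) (sym (enum-from j)) (enum-mono-< U i<j)))
      ; to∘from   = λ i → enum-injective U (trans (enum-to (from i)) (enum-from i))
      ; from∘to   = λ i → enum-injective V (enum-injective W (trans (enum-from (to i)) (enum-to i)))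
      }

  -- `V⊆U` and `U⊆V` say that `enum W` maps `V` onto `U`, so both sides list the same points in
  -- increasing order. The equality lives in `NC²` because `∣ V ∣` and `∣ U ∣` are not
  -- definitionally equal.
  ↾-↾ : .{{_ : NonZero ∣ V ∣}} .{{_ : NonZero ∣ U ∣}} → ⟨ π ↾ W ↾ V ,𝟙⟩ ≡ ⟨ π ↾ U ,𝟙⟩
  ↾-↾ = ⟨,𝟙⟩-iso (π ↾ W ↾ V) (π ↾ U) iso
    (λ {a} {b} a∼b → ↾⁺ π U (≡.subst₂ (SameBlock π) (sym (enum-to a)) (sym (enum-to b))
      (↾⁻ π W (↾⁻ (π ↾ W) V a∼b))))
    (λ {a} {b} a∼b → ↾⁺ (π ↾ W) V (↾⁺ π W (≡.subst₂ (SameBlock π) (enum-to a) (enum-to b)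
      (↾⁻ π U a∼b))))

-- Least elements of blocks, and their behaviour under refinement

module _ (σ : NC n) where

  leasts-unique : Unique (leasts σ)
  leasts-unique = Unique.filter⁺ (isLeast? σ) (Unique.allFin⁺ n)

  ∈-leasts⁺ : ∀ {i} → IsLeast σ i → i ∈ˡ leasts σ
  ∈-leasts⁺ = ∈-filter⁺ (isLeast? σ) (∈-allFin _)

  ∈-leasts⁻ : ∀ {i} → i ∈ˡ leasts σ → IsLeast σ i
  ∈-leasts⁻ i∈ = proj₂ (∈-filter⁻ (isLeast? σ) {xs = allFin n} i∈)

  leasts-≡ : ∀ {i j} → i ∈ˡ leasts σ → j ∈ˡ leasts σ → i ∼[ σ ] j → i ≡ j
  leasts-≡ i∈ j∈ i∼j = Fin.≤-antisym (∈-leasts⁻ i∈ _ i∼j) (∈-leasts⁻ j∈ _ (∼-sym σ i∼j))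

  leasts-cover : ∀ x → ∃[ i ] i ∈ˡ leasts σ × x ∈ block σ i
  leasts-cover x with i , i∈ , eq ← ∈-map⁻ (block σ) (block-∈ σ x) = i , i∈ , subst (x ∈_) eq (∼-refl σ)

module _ {ρ σ : NC n} (ρ⊑σ : ρ ⊑ σ) where

  block-closed : ∀ i {x y} → x ∈ block σ i → x ∼[ ρ ] y → y ∈ block σ i
  block-closed i x∈ x∼y = ∼-trans σ x∈ (coarsen ρ⊑σ x∼y)

  -- A block of `ρ` lies inside one block of `σ`, and `enum` is monotone, so taking least elements
  -- commutes with renumbering that block of `σ`. This regroups a product over the blocks of `ρ` by
  -- the blocks of `σ`.
  leasts-refine : leasts ρ ↭ concatMap (λ i → List.map (enum (block σ i)) (leasts (ρ ↾ block σ i))) (leasts σ)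
  leasts-refine = unique-↭ (leasts-unique ρ)
    (concatMap-unique inner (leasts-unique σ)
      (λ i → Unique.map⁺ (enum-injective (block σ i)) (leasts-unique (ρ ↾ block σ i)))
      (λ {i} {j} i∈ j∈ z∈i z∈j → leasts-≡ σ i∈ j∈ (∼-trans σ (inner⊆block i z∈i) (∼-sym σ (inner⊆block j z∈j)))))
    to from
    where
    inner : Fin n → List (Fin n)
    inner i = List.map (enum (block σ i)) (leasts (ρ ↾ block σ i))

    inner⊆block : ∀ i {z} → z ∈ˡ inner i → z ∈ block σ i
    inner⊆block i z∈ with a , _ , refl ← ∈-map⁻ (enum (block σ i)) z∈ = enum-∈ (block σ i) a

    to : ∀ {x} → x ∈ˡ leasts ρ → x ∈ˡ concatMap inner (leasts σ)
    to {x} x∈ with i , i∈ , x∈W ← leasts-cover σ x =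
      ∈-concatMap⁺ inner (lose i∈ (subst (_∈ˡ inner i) (enum-index x∈W) (∈-map⁺ (enum W) (∈-leasts⁺ (ρ ↾ W) least))))
      where
      W = block σ i

      least : IsLeast (ρ ↾ W) (index x∈W)
      least b a∼b = enum-cancel-≤ W (subst (Fin._≤ enum W b) (sym (enum-index x∈W))
        (∈-leasts⁻ ρ x∈ _ (subst (λ y → y ∼[ ρ ] enum W b) (enum-index x∈W) (↾⁻ ρ W a∼b))))

    from : ∀ {x} → x ∈ˡ concatMap inner (leasts σ) → x ∈ˡ leasts ρ
    from x∈ with i , i∈ , x∈i ← find (∈-concatMap⁻ inner {xs = leasts σ} x∈)
      with a , a∈ , refl ← ∈-map⁻ (enum (block σ i)) x∈i = ∈-leasts⁺ ρ least
      where
      W = block σ i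

      least : IsLeast ρ (enum W a)
      least y a∼y = subst (enum W a Fin.≤_) (enum-index y∈W) (enum-mono-≤ W
        (∈-leasts⁻ (ρ ↾ W) a∈ _ (↾⁺ ρ W (subst (SameBlock ρ (enum W a)) (sym (enum-index y∈W)) a∼y))))
        where
        y∈W : y ∈ W
        y∈W = block-closed i (enum-∈ W a) a∼y

  -- Because `ρ ⊑ σ`, a block of `ρ ↾ block σ i` is a whole block of `ρ` and not merely the trace of
  -- one.
  ↾-block-↾ : (π : NC n) (i : Fin n) (a : Fin ∣ block σ i ∣) →
    ⟨_,𝟙⟩ {{∣block∣≢0 (ρ ↾ block σ i) a}} (π ↾ block σ i ↾ block (ρ ↾ block σ i) a) ≡
    ⟨_,𝟙⟩ {{∣block∣≢0 ρ (enum (block σ i) a)}} (π ↾ block ρ (enum (block σ i) a))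
  ↾-block-↾ π i a = ↾-↾ π W (block (ρ ↾ W) a) (block ρ (enum W a)) (↾⁻ ρ W)
    (λ x∈ → let x∈W = block-closed i (enum-∈ W a) x∈ in
      index x∈W , ↾⁺ ρ W (subst (SameBlock ρ (enum W a)) (sym (enum-index x∈W)) x∈) , enum-index x∈W)
    {{∣block∣≢0 (ρ ↾ W) a}} {{∣block∣≢0 ρ (enum W a)}}
    where
    W = block σ i

-- The partitions finer than σ correspond to the families of partitions of
-- the blocks of σ.

module Gluing (σ : NC n) where

  Piece : Fin n → Set
  Piece i = NC ∣ block σ i ∣

  choices : ∀ is → List (All Piece is)
  choices []       = [] ∷ []
  choices (i ∷ is) = cartesianProductWith _∷_ (allNC _) (choices is)

  choices-unique : ∀ is → Unique (choices is)
  choices-unique []       = [] ∷ []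
  choices-unique (i ∷ is) = Unique.cartesianProductWith⁺ _∷_ (λ { refl → refl , refl }) (allNC-unique _) (choices-unique is)

  choices-complete : ∀ {is} (τs : All Piece is) → τs ∈ˡ choices is
  choices-complete []       = here refl
  choices-complete (τ ∷ τs) = ∈-cartesianProductWith⁺ _∷_ (allNC-complete τ) (choices-complete τs)

  restrict : NC n → ∀ is → All Piece is
  restrict ρ []       = []
  restrict ρ (i ∷ is) = ρ ↾ block σ i ∷ restrict ρ is

  lookup-restrict : ∀ ρ {i is} (i∈ : i ∈ˡ is) → All.lookup (restrict ρ is) i∈ ≡ ρ ↾ block σ i
  lookup-restrict ρ (here refl) = refl
  lookup-restrict ρ (there i∈)  = lookup-restrict ρ i∈

  Image : ∀ {i} → Piece i → Fin n → Fin n → Set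
  Image {i} τ x y = ∃[ a ] ∃[ b ] enum (block σ i) a ≡ x × enum (block σ i) b ≡ y × a ∼[ τ ] b

  Glue : ∀ {is} → All Piece is → Fin n → Fin n → Set
  Glue []       x y = ⊥
  Glue (τ ∷ τs) x y = Image τ x y ⊎ Glue τs x y

  Glue? : ∀ {is} (τs : All Piece is) x y → Dec (Glue τs x y)
  Glue? []       x y = no λ ()
  Glue? (τ ∷ τs) x y =
    (any? λ a → any? λ b → (enum _ a Fin.≟ x) ×-dec (enum _ b Fin.≟ y) ×-dec SameBlock? τ a b) ⊎-dec Glue? τs x y

  Glue⁺ : ∀ {i is} (τs : All Piece is) (i∈ : i ∈ˡ is) {x y} → Image (All.lookup τs i∈) x y → Glue τs x y
  Glue⁺ (τ ∷ τs) (here refl) x∼y = inj₁ x∼y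
  Glue⁺ (τ ∷ τs) (there i∈)  x∼y = inj₂ (Glue⁺ τs i∈ x∼y)

  Glue⁻ : ∀ {is} (τs : All Piece is) {x y} → Glue τs x y → ∃[ i ] ∃[ i∈ ] Image {i} (All.lookup τs i∈) x y
  Glue⁻ (τ ∷ τs) (inj₁ x∼y) = _ , here refl , x∼y
  Glue⁻ (τ ∷ τs) (inj₂ x∼y) = let i , i∈ , x∼y′ = Glue⁻ τs x∼y in i , there i∈ , x∼y′

  module _ (τs : All Piece (leasts σ)) where

    Glue-refl : ∀ {x} → Glue τs x x
    Glue-refl {x} = let i , i∈ , x∈W = leasts-cover σ x in
      Glue⁺ τs i∈ (index x∈W , index x∈W , enum-index x∈W , enum-index x∈W , ∼-refl (All.lookup τs i∈))

    Glue-sym : ∀ {x y} → Glue τs x y → Glue τs y x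
    Glue-sym x∼y = let i , i∈ , a , b , a≡x , b≡y , a∼b = Glue⁻ τs x∼y in
      Glue⁺ τs i∈ (b , a , b≡y , a≡x , ∼-sym (All.lookup τs i∈) a∼b)

    -- A related pair carries its own index `i′`. The shared point forces `i ≡ i′`, and since
    -- `leasts σ` has no repetitions the membership proofs agree too, so the piece can be prescribed
    -- through `i∈`.
    Glue-from : ∀ {i} (i∈ : i ∈ˡ leasts σ) {a y} → Glue τs (enum (block σ i) a) y →
                ∃[ b ] enum (block σ i) b ≡ y × a ∼[ All.lookup τs i∈ ] b
    Glue-from {i} i∈ {a} a∼y with i′ , i′∈ , a′ , b , a′≡a , b≡y , a′∼b ← Glue⁻ τs a∼y
      with refl ← leasts-≡ σ i∈ i′∈ (∼-trans σ (enum-∈ (block σ i) a)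
                    (∼-sym σ (subst (_∈ block σ i′) a′≡a (enum-∈ (block σ i′) a′))))
      with refl ← unique⇒irrelevant (leasts-unique σ) i∈ i′∈
      with refl ← enum-injective (block σ i) a′≡a = b , b≡y , a′∼b

    Glue-trans : ∀ {x y z} → Glue τs x y → Glue τs y z → Glue τs x z
    Glue-trans x∼y y∼z with i , i∈ , a , b , a≡x , refl , a∼b ← Glue⁻ τs x∼y
      with c , c≡z , b∼c ← Glue-from i∈ y∼z = Glue⁺ τs i∈ (a , c , a≡x , c≡z , ∼-trans (All.lookup τs i∈) a∼b b∼c)

    Glue⇒∼ : ∀ {x y} → Glue τs x y → x ∼[ σ ] y
    Glue⇒∼ x∼y with i , i∈ , a , b , refl , refl , _ ← Glue⁻ τs x∼y =
      ∼-trans σ (∼-sym σ (enum-∈ (block σ i) a)) (enum-∈ (block σ i) b)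

    Glue-isEquivalence : IsEquivalence (Glue τs)
    Glue-isEquivalence = record { refl = Glue-refl ; sym = Glue-sym ; trans = Glue-trans }

    -- Crossing classes would lie in one block of σ, because σ is
    -- non-crossing.
    Glue-nonCrossing : NonCrossing (Glue τs)
    Glue-nonCrossing {_} {y} x<y y<z z<w x∼z y∼w
      with i , i∈ , a , c , refl , refl , a∼c ← Glue⁻ τs x∼z
      with b , refl ← enum-surjective (∼-trans σ (enum-∈ (block σ i) a)
                    (∼-nonCrossing σ x<y y<z z<w (Glue⇒∼ x∼z) (Glue⇒∼ y∼w)))
      with d , refl , b∼d ← Glue-from i∈ y∼w =
      Glue⁺ τs i∈ (a , b , refl , refl , ∼-nonCrossing (All.lookup τs i∈)
        (enum-cancel-< W x<y) (enum-cancel-< W y<z) (enum-cancel-< W z<w) a∼c b∼d)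
      where
      W = block σ i

    glue : NC n
    glue = classes (Glue? τs) Glue-isEquivalence Glue-nonCrossing

    glue⁺ : ∀ {x y} → Glue τs x y → x ∼[ glue ] y
    glue⁺ = classes⁺ (Glue? τs) {Glue-isEquivalence} {Glue-nonCrossing}

    glue⁻ : ∀ {x y} → x ∼[ glue ] y → Glue τs x y
    glue⁻ = classes⁻ (Glue? τs) {Glue-isEquivalence} {Glue-nonCrossing}

    glue-⊑ : glue ⊑ σ
    glue-⊑ = coarser (Glue⇒∼ ∘ glue⁻)

    restrict-glue : restrict glue (leasts σ) ≡ τs
    restrict-glue = All-ext λ {i} i∈ → trans (lookup-restrict glue i∈) (NC-ext
      (λ {a} {b} a∼b → let b′ , b′≡b , a∼b′ = Glue-from i∈ (glue⁻ (↾⁻ glue (block σ i) a∼b)) in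
        subst (SameBlock (All.lookup τs i∈) a) (enum-injective (block σ i) b′≡b) a∼b′)
      (λ {a} {b} a∼b → ↾⁺ glue (block σ i) (glue⁺ (Glue⁺ τs i∈ (a , b , refl , refl , a∼b)))))

  glue-injective : ∀ {τs υs} → glue τs ≡ glue υs → τs ≡ υs
  glue-injective {τs} {υs} eq =
    trans (sym (restrict-glue τs)) (trans (cong (λ ρ → restrict ρ (leasts σ)) eq) (restrict-glue υs))

  -- The hypothesis enters in `from`: gluing sees only pairs inside a common block of `σ`, and
  -- `ρ ⊑ σ` puts every related pair into one.
  glue-restrict : {ρ : NC n} → ρ ⊑ σ → glue (restrict ρ (leasts σ)) ≡ ρ
  glue-restrict {ρ} ρ⊑σ = NC-ext to from
    where
    τs = restrict ρ (leasts σ)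

    to : ∀ {x y} → x ∼[ glue τs ] y → x ∼[ ρ ] y
    to x∼y with i , i∈ , a , b , refl , refl , a∼b ← Glue⁻ τs (glue⁻ τs x∼y) =
      ↾⁻ ρ (block σ i) (subst (λ τ → a ∼[ τ ] b) (lookup-restrict ρ i∈) a∼b)

    from : ∀ {x y} → x ∼[ ρ ] y → x ∼[ glue τs ] y
    from {x} {y} x∼y with i , i∈ , x∈W ← leasts-cover σ x =
      glue⁺ τs (Glue⁺ τs i∈ (index x∈W , index y∈W , enum-index x∈W , enum-index y∈W ,
        subst (λ τ → index x∈W ∼[ τ ] index y∈W) (sym (lookup-restrict ρ i∈))
          (↾⁺ ρ (block σ i) (≡.subst₂ (SameBlock ρ) (sym (enum-index x∈W)) (sym (enum-index y∈W)) x∼y))))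
      where
      y∈W : y ∈ block σ i
      y∈W = block-closed ρ⊑σ i x∈W x∼y

  finer-↭ : filter (_⊑? σ) (allNC n) ↭ List.map glue (choices (leasts σ))
  finer-↭ = unique-↭ (Unique.filter⁺ (_⊑? σ) (allNC-unique n))
    (Unique.map⁺ glue-injective (choices-unique (leasts σ)))
    (λ {ρ} ρ∈ → subst (_∈ˡ List.map glue (choices (leasts σ)))
      (glue-restrict (proj₂ (∈-filter⁻ (_⊑? σ) {xs = allNC n} ρ∈)))
      (∈-map⁺ glue (choices-complete (restrict ρ (leasts σ)))))
    (λ ρ∈ → let τs , _ , eq = ∈-map⁻ glue ρ∈ in
      subst (_∈ˡ filter (_⊑? σ) (allNC n)) (sym eq) (∈-filter⁺ (_⊑? σ) (allNC-complete (glue τs)) (glue-⊑ τs)))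

-- Concatenations and cuts

module _ (π₁ : NC m) (π₂ : NC n) where

  private
    _∼_ : Fin m ⊎ Fin n → Fin m ⊎ Fin n → Set
    _∼_ = Pointwise (SameBlock π₁) (SameBlock π₂)

    noncrossing : ∀ {i j k l} → (_<_ ⊎-< _<_) i j → (_<_ ⊎-< _<_) j k → (_<_ ⊎-< _<_) k l → i ∼ k → j ∼ l → i ∼ j
    noncrossing (₁∼₁ p) (₁∼₁ q) (₁∼₁ r) (inj₁ a) (inj₁ b) = inj₁ (∼-nonCrossing π₁ p q r a b)
    noncrossing (₂∼₂ p) (₂∼₂ q) (₂∼₂ r) (inj₂ a) (inj₂ b) = inj₂ (∼-nonCrossing π₂ p q r a b)

    isEquivalence-◇ : IsEquivalence (_∼_ on splitAt m)
    isEquivalence-◇ = On.isEquivalence (splitAt m) (⊎-isEquivalence (∼-isEquivalence π₁) (∼-isEquivalence π₂))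

    nonCrossing-◇ : NonCrossing (_∼_ on splitAt m)
    nonCrossing-◇ i<j j<k k<l = noncrossing (splitAt-mono-< m i<j) (splitAt-mono-< m j<k) (splitAt-mono-< m k<l)

  ◇⁺ : ∀ {i j} → splitAt m i ∼ splitAt m j → i ∼[ π₁ ◇ π₂ ] j
  ◇⁺ = classes⁺ (λ i j → ⊎-decidable (SameBlock? π₁) (SameBlock? π₂) (splitAt m i) (splitAt m j))
    {isEquivalence-◇} {nonCrossing-◇}

  ◇⁻ : ∀ {i j} → i ∼[ π₁ ◇ π₂ ] j → splitAt m i ∼ splitAt m j
  ◇⁻ = classes⁻ (λ i j → ⊎-decidable (SameBlock? π₁) (SameBlock? π₂) (splitAt m i) (splitAt m j))
    {isEquivalence-◇} {nonCrossing-◇}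

module _ (f : Fin m → Fin n) (f-mono : ∀ {i j} → i < j → f i < f j) (π : NC n) where

  private
    isEquivalence-on : IsEquivalence (SameBlock π on f)
    isEquivalence-on = On.isEquivalence f (∼-isEquivalence π)

    nonCrossing-on : NonCrossing (SameBlock π on f)
    nonCrossing-on i<j j<k k<l = ∼-nonCrossing π (f-mono i<j) (f-mono j<k) (f-mono k<l)

  pullback : NC m
  pullback = classes (λ i j → SameBlock? π (f i) (f j)) isEquivalence-on nonCrossing-on

  pullback⁺ : ∀ {i j} → f i ∼[ π ] f j → i ∼[ pullback ] j
  pullback⁺ = classes⁺ (λ i j → SameBlock? π (f i) (f j)) {isEquivalence-on} {nonCrossing-on}

  pullback⁻ : ∀ {i j} → i ∼[ pullback ] j → f i ∼[ π ] f j
  pullback⁻ = classes⁻ (λ i j → SameBlock? π (f i) (f j)) {isEquivalence-on} {nonCrossing-on}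

-- A cut of the points into a left part (false) and a right part (true).

Cut : (Fin n → Bool) → Set
Cut p = ∀ {i j} → i < j → p i ≡ true → p j ≡ true

Respects : (Fin n → Bool) → NC n → Set
Respects p π = ∀ {i j} → i ∼[ π ] j → p i ≡ false → p j ≢ true

-- `c` counts the points left of the cut. The type of `_◇_` mentions both sizes, so a cut needs a
-- position before it can be compared with a concatenation.
threshold : (p : Fin n → Bool) → Cut p →
  ∃[ c ] c ℕ.≤ n × (∀ i → toℕ i ℕ.< c → p i ≡ false) × (∀ i → c ℕ.≤ toℕ i → p i ≡ true)
threshold {zero}  p cut = 0 , z≤n , (λ ()) , (λ ())
threshold {suc n} p cut with p zero in p0
... | true  = 0 , z≤n , (λ _ ()) , λ { zero _ → p0 ; (suc i) _ → cut (s≤s z≤n) p0 }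
... | false = let c , c≤n , left , right = threshold (p ∘ suc) (cut ∘ s≤s) in
  suc c , s≤s c≤n , (λ { zero _ → p0 ; (suc i) (s≤s i<c) → left i i<c }) , λ { (suc i) (s≤s c≤i) → right i c≤i }

separated⇒◇ : (π : NC (m ℕ.+ n)) → (∀ a b → ¬ (a Fin.↑ˡ n) ∼[ π ] (m Fin.↑ʳ b)) →
              ∃[ π₁ ] ∃[ π₂ ] _◇_ {m} {n} π₁ π₂ ≡ π
separated⇒◇ {m} {n} π separated = π₁ , π₂ , NC-ext (λ i∼j → from _ _ (◇⁻ π₁ π₂ i∼j)) (λ i∼j → ◇⁺ π₁ π₂ (to _ _ i∼j))
  where
  left-mono : {i j : Fin m} → i < j → i Fin.↑ˡ n < j Fin.↑ˡ n
  left-mono {i} {j} = ≡.subst₂ ℕ._<_ (sym (Fin.toℕ-↑ˡ i n)) (sym (Fin.toℕ-↑ˡ j n))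

  right-mono : {i j : Fin n} → i < j → m Fin.↑ʳ i < m Fin.↑ʳ j
  right-mono {i} {j} i<j = ≡.subst₂ ℕ._<_ (sym (Fin.toℕ-↑ʳ m i)) (sym (Fin.toℕ-↑ʳ m j)) (ℕ.+-monoʳ-< m i<j)

  π₁ = pullback (Fin._↑ˡ n) left-mono π
  π₂ = pullback (m Fin.↑ʳ_) right-mono π

  from : ∀ i j → Pointwise (SameBlock π₁) (SameBlock π₂) (splitAt m i) (splitAt m j) → i ∼[ π ] j
  from i j i∼j with splitAt m i in eqi | splitAt m j in eqj | i∼j
  ... | inj₁ a | inj₁ b | inj₁ a∼b = ≡.subst₂ (SameBlock π) (Fin.splitAt⁻¹-↑ˡ eqi) (Fin.splitAt⁻¹-↑ˡ eqj)
    (pullback⁻ (Fin._↑ˡ n) left-mono π a∼b)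
  ... | inj₂ a | inj₂ b | inj₂ a∼b = ≡.subst₂ (SameBlock π) (Fin.splitAt⁻¹-↑ʳ eqi) (Fin.splitAt⁻¹-↑ʳ eqj)
    (pullback⁻ (m Fin.↑ʳ_) right-mono π a∼b)

  to : ∀ i j → i ∼[ π ] j → Pointwise (SameBlock π₁) (SameBlock π₂) (splitAt m i) (splitAt m j)
  to i j i∼j with splitAt m i in eqi | splitAt m j in eqj
  ... | inj₁ a | inj₁ b = inj₁ (pullback⁺ (Fin._↑ˡ n) left-mono π
    (≡.subst₂ (SameBlock π) (sym (Fin.splitAt⁻¹-↑ˡ eqi)) (sym (Fin.splitAt⁻¹-↑ˡ eqj)) i∼j))
  ... | inj₂ a | inj₂ b = inj₂ (pullback⁺ (m Fin.↑ʳ_) right-mono π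
    (≡.subst₂ (SameBlock π) (sym (Fin.splitAt⁻¹-↑ʳ eqi)) (sym (Fin.splitAt⁻¹-↑ʳ eqj)) i∼j))
  ... | inj₁ a | inj₂ b = contradiction
    (≡.subst₂ (SameBlock π) (sym (Fin.splitAt⁻¹-↑ˡ eqi)) (sym (Fin.splitAt⁻¹-↑ʳ eqj)) i∼j) (separated a b)
  ... | inj₂ a | inj₁ b = contradiction
    (≡.subst₂ (SameBlock π) (sym (Fin.splitAt⁻¹-↑ˡ eqj)) (sym (Fin.splitAt⁻¹-↑ʳ eqi)) (∼-sym π i∼j)) (separated b a)

module _ (m {n} : ℕ) where

  isRight : Fin (m ℕ.+ n) → Bool
  isRight = [ const false , const true ]′ ∘ splitAt m

  isRight-Cut : Cut isRight
  isRight-Cut {i} {j} i<j ri with splitAt m i | splitAt m j | splitAt-mono-< m i<j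
  ... | inj₁ _ | _      | _ = contradiction ri λ ()
  ... | inj₂ _ | inj₂ _ | _ = refl

  isRight-↑ˡ : ∀ a → isRight (a Fin.↑ˡ n) ≡ false
  isRight-↑ˡ a = cong ([ const false , const true ]′) (Fin.splitAt-↑ˡ m a n)

  isRight-↑ʳ : ∀ b → isRight (m Fin.↑ʳ b) ≡ true
  isRight-↑ʳ b = cong ([ const false , const true ]′) (Fin.splitAt-↑ʳ m n b)

  ◇-Respects : (π₁ : NC m) (π₂ : NC n) → Respects isRight (π₁ ◇ π₂)
  ◇-Respects π₁ π₂ {i} {j} i∼j li rj with splitAt m i | splitAt m j | ◇⁻ π₁ π₂ i∼j
  ... | inj₁ _ | inj₁ _ | _ = contradiction rj λ ()
  ... | inj₂ _ | inj₂ _ | _ = contradiction li λ ()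

-- A measure that drops under strict coarsening

⋢-witness : (π ρ : NC n) → ¬ π ⊑ ρ → ∃[ i ] ∃[ j ] i ∼[ π ] j × ¬ i ∼[ ρ ] j
⋢-witness π ρ π⋢ρ with any? (λ i → any? λ j → SameBlock? π i j ×-dec ¬? (SameBlock? ρ i j))
... | yes witness = witness
... | no none     = contradiction
  (coarser λ {i} {j} i∼j → decidable-stable (SameBlock? ρ i j) λ i≁j → none (i , j , i∼j , i≁j)) π⋢ρ

⊑∧≢⇒⋣ : {π ρ : NC n} → π ⊑ ρ → π ≢ ρ → ¬ ρ ⊑ π
⊑∧≢⇒⋣ π⊑ρ π≢ρ ρ⊑π = π≢ρ (⊑-antisym π⊑ρ ρ⊑π)

sum-mono-≤ : {f g : A → ℕ} (xs : List A) → (∀ x → f x ℕ.≤ g x) → sumℕ (List.map f xs) ℕ.≤ sumℕ (List.map g xs)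
sum-mono-≤ []       f≤g = z≤n
sum-mono-≤ (x ∷ xs) f≤g = ℕ.+-mono-≤ (f≤g x) (sum-mono-≤ xs f≤g)

sum-mono-< : {f g : A → ℕ} → (∀ x → f x ℕ.≤ g x) → y ∈ˡ xs → f y ℕ.< g y →
             sumℕ (List.map f xs) ℕ.< sumℕ (List.map g xs)
sum-mono-< {xs = x ∷ xs} f≤g (here refl) fy<gy = ℕ.+-mono-<-≤ fy<gy (sum-mono-≤ xs f≤g)
sum-mono-< {xs = x ∷ xs} f≤g (there y∈)  fy<gy = ℕ.+-mono-≤-< (f≤g x) (sum-mono-< f≤g y∈ fy<gy)

-- Summing over points rather than blocks lets a coarsening be compared summand by summand: the
-- block of each point grows or stays, and grows strictly at the point found by `⋢-witness`.
corank : NC n → ℕ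
corank {n} π = sumℕ (List.map (λ i → n ℕ.∸ ∣ block π i ∣) (allFin n))

corank-< : {π ρ : NC n} → π ⊑ ρ → π ≢ ρ → corank ρ ℕ.< corank π
corank-< {n} {π} {ρ} π⊑ρ π≢ρ
  with i , j , i∼j , i≁j ← ⋢-witness ρ π (⊑∧≢⇒⋣ π⊑ρ π≢ρ) =
  sum-mono-< (λ i → ℕ.∸-monoʳ-≤ n (p⊆q⇒∣p∣≤∣q∣ (π⊆ρ i))) (∈-allFin i)
    (ℕ.∸-monoʳ-< (p⊂q⇒∣p∣<∣q∣ (π⊆ρ i , j , i∼j , i≁j)) (∣p∣≤n (block ρ i)))
  where
  π⊆ρ : ∀ i → block π i ⊆ block ρ i
  π⊆ρ i = coarsen π⊑ρ

-- The convolution algebra on `NC²`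

module Convolution {c ℓ} (R : CommutativeRing c ℓ) where

  open Functions R
  open CommutativeRing R hiding (zero) renaming (refl to ≈-refl; sym to ≈-sym; trans to ≈-trans)
  open RingProperties ring using (+-cancelˡ)
  open SetoidReasoning setoid

  open Fold +-commutativeMonoid using () renaming
    ( fold to sum; fold-cong to sum-cong; fold-ε to sum-0; fold-∙ to sum-+; fold-swap to sum-swap; fold-++ to sum-++
    ; fold-map to sum-map; fold-↭ to sum-↭; fold-single to sum-single; fold-filter to sum-filter)
  open Fold *-commutativeMonoid using () renaming
    ( fold to prod; fold-cong to prod-cong; fold-ε to prod-1; fold-∙ to prod-*; fold-concatMap to prod-concatMap
    ; fold-map to prod-map; fold-↭ to prod-↭)

  private
    variable
      f g h : Fun

  sum-*ˡ : ∀ a (F : A → Carrier) xs → a * sum F xs ≈ sum (λ x → a * F x) xs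
  sum-*ˡ a F []       = zeroʳ a
  sum-*ˡ a F (x ∷ xs) = ≈-trans (distribˡ a _ _) (+-congˡ (sum-*ˡ a F xs))

  sum-*ʳ : ∀ a (F : A → Carrier) xs → sum F xs * a ≈ sum (λ x → F x * a) xs
  sum-*ʳ a F []       = zeroˡ a
  sum-*ʳ a F (x ∷ xs) = ≈-trans (distribʳ a _ _) (+-congˡ (sum-*ʳ a F xs))

  prod-0 : {F : A → Carrier} → y ∈ˡ xs → F y ≈ 0# → prod F xs ≈ 0#
  prod-0 (here refl) Fy≈0 = ≈-trans (*-congʳ Fy≈0) (zeroˡ _)
  prod-0 (there y∈)  Fy≈0 = ≈-trans (*-congˡ (prod-0 y∈ Fy≈0)) (zeroʳ _)

  -- Extending functions on NC² by zero to all pairs turns convolution into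
  -- matrix multiplication.

  infix 30 _⟦_,_⟧
  _⟦_,_⟧ : Fun → .{{NonZero n}} → NC n → NC n → Carrier
  f ⟦ π , σ ⟧ with π ⊑? σ
  ... | yes π⊑σ = f (pair π σ (⊑⇒≼ π⊑σ))
  ... | no  _   = 0#

  module _ .{{_ : NonZero n}} {π σ : NC n} where

    ⟦⟧-⊑ : ∀ f (π⊑σ : π ⊑ σ) → f ⟦ π , σ ⟧ ≡ f (pair π σ (⊑⇒≼ π⊑σ))
    ⟦⟧-⊑ f π⊑σ with π ⊑? σ
    ... | yes _  = refl
    ... | no π⋢σ = contradiction π⊑σ π⋢σ

    ⟦⟧-⋢ : ∀ f → ¬ π ⊑ σ → f ⟦ π , σ ⟧ ≡ 0#
    ⟦⟧-⋢ f π⋢σ with π ⊑? σ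
    ... | yes π⊑σ = contradiction π⊑σ π⋢σ
    ... | no _    = refl

    -- Agreement at a single pair suffices. The number of terms used by `inverse` depends on the
    -- lower partition, so its comparison with a partial sum is made pair by pair.
    ⟦⟧-local : (∀ .(π≼σ : π ≼ σ) → f (pair π σ π≼σ) ≈ g (pair π σ π≼σ)) → f ⟦ π , σ ⟧ ≈ g ⟦ π , σ ⟧
    ⟦⟧-local f≈g with π ⊑? σ
    ... | yes π⊑σ = f≈g (⊑⇒≼ π⊑σ)
    ... | no _    = ≈-refl

    ⟦⟧-cong : f ≐ g → f ⟦ π , σ ⟧ ≈ g ⟦ π , σ ⟧
    ⟦⟧-cong f≐g = ⟦⟧-local λ π≼σ → f≐g (pair π σ π≼σ)

    ⟦⟧-+ : ∀ f g → (λ x → f x + g x) ⟦ π , σ ⟧ ≈ f ⟦ π , σ ⟧ + g ⟦ π , σ ⟧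
    ⟦⟧-+ f g with π ⊑? σ
    ... | yes _ = ≈-refl
    ... | no _  = ≈-sym (+-identityˡ 0#)

  ⟦⟧-≐ : (∀ {n} .{{_ : NonZero n}} {π σ : NC n} → π ⊑ σ → f ⟦ π , σ ⟧ ≈ g ⟦ π , σ ⟧) → f ≐ g
  ⟦⟧-≐ {f} {g} f≈g (pair π σ π≼σ) = begin
    f (pair π σ _) ≡⟨ ⟦⟧-⊑ f π⊑σ ⟨
    f ⟦ π , σ ⟧    ≈⟨ f≈g π⊑σ ⟩
    g ⟦ π , σ ⟧    ≡⟨ ⟦⟧-⊑ g π⊑σ ⟩
    g (pair π σ _) ∎
    where
    π⊑σ : π ⊑ σ
    π⊑σ = recompute-⊑ π≼σ

  module _ .{{_ : NonZero n}} where

    ⟦⟧-*-outside : ∀ f g {π ρ σ : NC n} → ¬ (π ⊑ ρ × ρ ⊑ σ) → f ⟦ π , ρ ⟧ * g ⟦ ρ , σ ⟧ ≈ 0#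
    ⟦⟧-*-outside f g {π} {ρ} {σ} ρ∉ with π ⊑? ρ | ρ ⊑? σ
    ... | yes π⊑ρ | yes ρ⊑σ = contradiction (π⊑ρ , ρ⊑σ) ρ∉
    ... | yes _   | no _    = zeroʳ _
    ... | no _    | _       = zeroˡ _

    TermView-⟦⟧ : ∀ {f g x} {π σ ρ : NC n} → TermView R f g π σ ρ x → x ≈ f ⟦ π , ρ ⟧ * g ⟦ ρ , σ ⟧
    TermView-⟦⟧ {f} {g} (between π≼ρ ρ≼σ)     = reflexive (≡.cong₂ _*_
      (sym (⟦⟧-⊑ f (recompute-⊑ π≼ρ))) (sym (⟦⟧-⊑ g (recompute-⊑ ρ≼σ))))
    TermView-⟦⟧ {f} {g} (elsewhere ρ∉[π,σ]) =
      ≈-sym (⟦⟧-*-outside f g λ (π⊑ρ , ρ⊑σ) → ρ∉[π,σ] (⊑⇒≼ π⊑ρ) (⊑⇒≼ ρ⊑σ))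

    ⋆-⟦⟧ : ∀ f g (π σ : NC n) → (f ⋆ g) ⟦ π , σ ⟧ ≈ sum (λ ρ → f ⟦ π , ρ ⟧ * g ⟦ ρ , σ ⟧) (allNC n)
    ⋆-⟦⟧ f g π σ with π ⊑? σ
    ... | yes _  = sum-cong {xs = allNC n} λ {ρ} _ → TermView-⟦⟧ (termView R f g π σ ρ)
    ... | no π⋢σ = ≈-sym (sum-0 {xs = allNC n} λ _ → ⟦⟧-*-outside f g λ (π⊑ρ , ρ⊑σ) → π⋢σ (⊑-trans π⊑ρ ρ⊑σ))

    e-diagonal : (π : NC n) → e ⟦ π , π ⟧ ≈ 1#
    e-diagonal π = reflexive (trans (⟦⟧-⊑ e (⊑-refl π))
      (cong (λ b → if b then 1# else 0#) (dec-true (π ≟ π) refl)))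

    e-off-diagonal : {π σ : NC n} → π ≢ σ → e ⟦ π , σ ⟧ ≈ 0#
    e-off-diagonal {π} {σ} π≢σ with π ⊑? σ
    ... | no _  = ≈-refl
    ... | yes _ = reflexive (cong (λ b → if b then 1# else 0#) (dec-false (π ≟ σ) π≢σ))

  ⋆-cong : {f f′ g g′ : Fun} → f ≐ f′ → g ≐ g′ → f ⋆ g ≐ f′ ⋆ g′
  ⋆-cong {f} {f′} {g} {g′} f≐f′ g≐g′ = ⟦⟧-≐ λ {n} {π} {σ} _ → begin
    (f ⋆ g) ⟦ π , σ ⟧                                    ≈⟨ ⋆-⟦⟧ f g π σ ⟩
    sum (λ ρ → f ⟦ π , ρ ⟧ * g ⟦ ρ , σ ⟧) (allNC n)       ≈⟨ sum-cong {xs = allNC n} (λ _ →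
                                                              *-cong (⟦⟧-cong f≐f′) (⟦⟧-cong g≐g′)) ⟩
    sum (λ ρ → f′ ⟦ π , ρ ⟧ * g′ ⟦ ρ , σ ⟧) (allNC n)     ≈⟨ ⋆-⟦⟧ f′ g′ π σ ⟨
    (f′ ⋆ g′) ⟦ π , σ ⟧                                  ∎

  ⋆-identityˡ : ∀ f → e ⋆ f ≐ f
  ⋆-identityˡ f = ⟦⟧-≐ λ {n} {π} {σ} _ → begin
    (e ⋆ f) ⟦ π , σ ⟧                                ≈⟨ ⋆-⟦⟧ e f π σ ⟩
    sum (λ ρ → e ⟦ π , ρ ⟧ * f ⟦ ρ , σ ⟧) (allNC n)   ≈⟨ sum-single (allNC-unique n) (allNC-complete π) (λ _ ρ≢π →
                                                          ≈-trans (*-congʳ (e-off-diagonal (ρ≢π ∘ sym))) (zeroˡ _)) ⟩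
    e ⟦ π , π ⟧ * f ⟦ π , σ ⟧                        ≈⟨ *-congʳ (e-diagonal π) ⟩
    1# * f ⟦ π , σ ⟧                                 ≈⟨ *-identityˡ _ ⟩
    f ⟦ π , σ ⟧                                      ∎

  ⋆-identityʳ : ∀ f → f ⋆ e ≐ f
  ⋆-identityʳ f = ⟦⟧-≐ λ {n} {π} {σ} _ → begin
    (f ⋆ e) ⟦ π , σ ⟧                                ≈⟨ ⋆-⟦⟧ f e π σ ⟩
    sum (λ ρ → f ⟦ π , ρ ⟧ * e ⟦ ρ , σ ⟧) (allNC n)   ≈⟨ sum-single (allNC-unique n) (allNC-complete σ) (λ _ ρ≢σ →
                                                          ≈-trans (*-congˡ (e-off-diagonal ρ≢σ)) (zeroʳ _)) ⟩
    f ⟦ π , σ ⟧ * e ⟦ σ , σ ⟧                        ≈⟨ *-congˡ (e-diagonal σ) ⟩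
    f ⟦ π , σ ⟧ * 1#                                 ≈⟨ *-identityʳ _ ⟩
    f ⟦ π , σ ⟧                                      ∎

  ⋆-assoc : ∀ f g h → (f ⋆ g) ⋆ h ≐ f ⋆ (g ⋆ h)
  ⋆-assoc f g h = ⟦⟧-≐ λ {n} {π} {σ} _ → let Π = allNC n in begin
    ((f ⋆ g) ⋆ h) ⟦ π , σ ⟧
      ≈⟨ ⋆-⟦⟧ (f ⋆ g) h π σ ⟩
    sum (λ τ → (f ⋆ g) ⟦ π , τ ⟧ * h ⟦ τ , σ ⟧) Π
      ≈⟨ sum-cong {xs = Π} (λ {τ} _ → ≈-trans (*-congʳ (⋆-⟦⟧ f g π τ)) (sum-*ʳ _ _ Π)) ⟩
    sum (λ τ → sum (λ ρ → f ⟦ π , ρ ⟧ * g ⟦ ρ , τ ⟧ * h ⟦ τ , σ ⟧) Π) Π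
      ≈⟨ sum-swap _ Π Π ⟩
    sum (λ ρ → sum (λ τ → f ⟦ π , ρ ⟧ * g ⟦ ρ , τ ⟧ * h ⟦ τ , σ ⟧) Π) Π
      ≈⟨ sum-cong {xs = Π} (λ _ → sum-cong {xs = Π} λ _ → *-assoc _ _ _) ⟩
    sum (λ ρ → sum (λ τ → f ⟦ π , ρ ⟧ * (g ⟦ ρ , τ ⟧ * h ⟦ τ , σ ⟧)) Π) Π
      ≈⟨ sum-cong {xs = Π} (λ {ρ} _ → ≈-trans (*-congˡ (⋆-⟦⟧ g h ρ σ)) (sum-*ˡ _ _ Π)) ⟨
    sum (λ ρ → f ⟦ π , ρ ⟧ * (g ⋆ h) ⟦ ρ , σ ⟧) Π
      ≈⟨ ⋆-⟦⟧ f (g ⋆ h) π σ ⟨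
    (f ⋆ (g ⋆ h)) ⟦ π , σ ⟧
      ∎

  ≐-refl : f ≐ f
  ≐-refl x = ≈-refl

  ≐-sym : f ≐ g → g ≐ f
  ≐-sym f≐g x = ≈-sym (f≐g x)

  ≐-trans : f ≐ g → g ≐ h → f ≐ h
  ≐-trans f≐g g≐h x = ≈-trans (f≐g x) (g≐h x)

  -- The inverse of a unital function g is the Neumann series of d = e - g,
  -- whose k-th partial sum is correct at (π , σ) as soon as k exceeds the
  -- corank of π, because d vanishes on the diagonal.

  Unital : Fun → Set ℓ
  Unital g = ∀ {n} .{{_ : NonZero n}} (π : NC n) → g ⟦ π , π ⟧ ≈ 1#

  defect : Fun → Fun
  defect g x = e x - g x

  partialSum : Fun → ℕ → Fun
  partialSum g zero    x = 0#
  partialSum g (suc k) x = e x + (defect g ⋆ partialSum g k) x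

  inverse : Fun → Fun
  inverse g x = partialSum g (suc (corank (NC².lower x))) x

  module _ .{{_ : NonZero n}} where

    defect-⟦⟧ : ∀ g (π ρ : NC n) → defect g ⟦ π , ρ ⟧ ≈ e ⟦ π , ρ ⟧ - g ⟦ π , ρ ⟧
    defect-⟦⟧ g π ρ with π ⊑? ρ
    ... | yes _ = ≈-refl
    ... | no _  = ≈-sym (-‿inverseʳ 0#)

    partialSum-⟦⟧ : ∀ g k (π σ : NC n) → partialSum g (suc k) ⟦ π , σ ⟧ ≈
      e ⟦ π , σ ⟧ + sum (λ ρ → defect g ⟦ π , ρ ⟧ * partialSum g k ⟦ ρ , σ ⟧) (allNC n)
    partialSum-⟦⟧ g k π σ = ≈-trans (⟦⟧-+ e _) (+-congˡ (⋆-⟦⟧ (defect g) (partialSum g k) π σ))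

  module _ (g : Fun) (g-unital : Unital g) where

    module _ .{{_ : NonZero n}} where

      defect-diagonal : (π : NC n) → defect g ⟦ π , π ⟧ ≈ 0#
      defect-diagonal π = begin
        defect g ⟦ π , π ⟧        ≈⟨ defect-⟦⟧ g π π ⟩
        e ⟦ π , π ⟧ - g ⟦ π , π ⟧ ≈⟨ +-cong (e-diagonal π) (-‿cong (g-unital π)) ⟩
        1# - 1#                   ≈⟨ -‿inverseʳ 1# ⟩
        0#                        ∎

      -- The weight `defect g ⟦ π , ρ ⟧` is zero at `ρ = π` and wherever `π ⊑ ρ` fails. What remains
      -- is strictly coarser than `π`, where `corank` has dropped.
      defect-sum-cong : (π : NC n) {F G : NC n → Carrier} → (∀ {ρ} → corank ρ ℕ.< corank π → F ρ ≈ G ρ) →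
        sum (λ ρ → defect g ⟦ π , ρ ⟧ * F ρ) (allNC n) ≈ sum (λ ρ → defect g ⟦ π , ρ ⟧ * G ρ) (allNC n)
      defect-sum-cong π {F} {G} F≈G = sum-cong {xs = allNC n} λ {ρ} _ → step ρ
        where
        both-0 : ∀ {a b c} → a ≈ 0# → a * b ≈ a * c
        both-0 a≈0 = ≈-trans (≈-trans (*-congʳ a≈0) (zeroˡ _)) (≈-sym (≈-trans (*-congʳ a≈0) (zeroˡ _)))

        step : ∀ ρ → defect g ⟦ π , ρ ⟧ * F ρ ≈ defect g ⟦ π , ρ ⟧ * G ρ
        step ρ with π ≟ ρ
        ... | yes refl = both-0 (defect-diagonal π)
        ... | no π≢ρ with π ⊑? ρ
        ...   | no _    = both-0 ≈-refl
        ...   | yes π⊑ρ = *-congˡ (F≈G (corank-< π⊑ρ π≢ρ))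

      -- Losing one term on each side is paid for by the drop of `corank` at every `ρ` that carries
      -- weight, so both bounds persist.
      partialSum-stable : ∀ k l (π σ : NC n) → corank π ℕ.< k → corank π ℕ.< l →
        partialSum g k ⟦ π , σ ⟧ ≈ partialSum g l ⟦ π , σ ⟧
      partialSum-stable (suc k) (suc l) π σ (s≤s π≤k) (s≤s π≤l) = begin
        partialSum g (suc k) ⟦ π , σ ⟧ ≈⟨ partialSum-⟦⟧ g k π σ ⟩
        e ⟦ π , σ ⟧ + sum (λ ρ → defect g ⟦ π , ρ ⟧ * partialSum g k ⟦ ρ , σ ⟧) (allNC n)
          ≈⟨ +-congˡ (defect-sum-cong π λ {ρ} ρ<π →
               partialSum-stable k l ρ σ (ℕ.<-≤-trans ρ<π π≤k) (ℕ.<-≤-trans ρ<π π≤l)) ⟩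
        e ⟦ π , σ ⟧ + sum (λ ρ → defect g ⟦ π , ρ ⟧ * partialSum g l ⟦ ρ , σ ⟧) (allNC n)
          ≈⟨ partialSum-⟦⟧ g l π σ ⟨
        partialSum g (suc l) ⟦ π , σ ⟧ ∎

      inverse-⟦⟧ : ∀ k (π σ : NC n) → corank π ℕ.< k → inverse g ⟦ π , σ ⟧ ≈ partialSum g k ⟦ π , σ ⟧
      inverse-⟦⟧ k π σ π<k = ≈-trans (⟦⟧-local {f = inverse g} {g = partialSum g (suc (corank π))} λ _ → ≈-refl)
        (partialSum-stable (suc (corank π)) k π σ (ℕ.n<1+n _) π<k)

      inverse-fixpoint : (π σ : NC n) →
        inverse g ⟦ π , σ ⟧ ≈ e ⟦ π , σ ⟧ + sum (λ ρ → defect g ⟦ π , ρ ⟧ * inverse g ⟦ ρ , σ ⟧) (allNC n)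
      inverse-fixpoint π σ = begin
        inverse g ⟦ π , σ ⟧ ≈⟨ inverse-⟦⟧ (suc (corank π)) π σ (ℕ.n<1+n _) ⟩
        partialSum g (suc (corank π)) ⟦ π , σ ⟧ ≈⟨ partialSum-⟦⟧ g (corank π) π σ ⟩
        e ⟦ π , σ ⟧ + sum (λ ρ → defect g ⟦ π , ρ ⟧ * partialSum g (corank π) ⟦ ρ , σ ⟧) (allNC n)
          -- `corank π` terms are one short of the bound at `π` itself, but enough at every strictly
          -- coarser `ρ`, and `π` carries no weight.
          ≈⟨ +-congˡ (defect-sum-cong π λ {ρ} ρ<π → inverse-⟦⟧ (corank π) ρ σ ρ<π) ⟨
        e ⟦ π , σ ⟧ + sum (λ ρ → defect g ⟦ π , ρ ⟧ * inverse g ⟦ ρ , σ ⟧) (allNC n) ∎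

    inverse-unital : Unital (inverse g)
    inverse-unital {n} π = begin
      inverse g ⟦ π , π ⟧ ≈⟨ inverse-fixpoint π π ⟩
      e ⟦ π , π ⟧ + sum (λ ρ → defect g ⟦ π , ρ ⟧ * inverse g ⟦ ρ , π ⟧) (allNC n)
        ≈⟨ +-cong (e-diagonal π) (sum-0 {xs = allNC n} λ {ρ} _ → vanishes ρ (π ≟ ρ)) ⟩
      1# + 0# ≈⟨ +-identityʳ 1# ⟩
      1# ∎
      where
      vanishes : ∀ ρ → Dec (π ≡ ρ) → defect g ⟦ π , ρ ⟧ * inverse g ⟦ ρ , π ⟧ ≈ 0#
      vanishes ρ (yes refl) = ≈-trans (*-congʳ (defect-diagonal π)) (zeroˡ _)
      vanishes ρ (no π≢ρ)   = ⟦⟧-*-outside (defect g) (inverse g) λ (π⊑ρ , ρ⊑π) → π≢ρ (⊑-antisym π⊑ρ ρ⊑π)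

    -- With `h = inverse g` and `d = defect g`, the sum `d ⋆ h + g ⋆ h` is `e ⋆ h`, hence `h`. The
    -- fixpoint equation `h = e + d ⋆ h` then leaves `g ⋆ h = e` after cancelling `d ⋆ h`.
    inverseʳ : g ⋆ inverse g ≐ e
    inverseʳ = ⟦⟧-≐ λ {n} {π} {σ} _ →
      let
        D = sum (λ ρ → defect g ⟦ π , ρ ⟧ * inverse g ⟦ ρ , σ ⟧) (allNC n)
        G = sum (λ ρ → g ⟦ π , ρ ⟧ * inverse g ⟦ ρ , σ ⟧) (allNC n)
      in +-cancelˡ D _ _ (begin
      D + (g ⋆ inverse g) ⟦ π , σ ⟧ ≈⟨ +-congˡ (⋆-⟦⟧ g (inverse g) π σ) ⟩
      D + G                         ≈⟨ sum-+ (allNC n) ⟨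
      sum (λ ρ → defect g ⟦ π , ρ ⟧ * inverse g ⟦ ρ , σ ⟧ + g ⟦ π , ρ ⟧ * inverse g ⟦ ρ , σ ⟧) (allNC n)
        ≈⟨ sum-cong {xs = allNC n} (λ {ρ} _ → ≈-trans (≈-sym (distribʳ _ _ _)) (*-congʳ (defect-+ π ρ))) ⟩
      sum (λ ρ → e ⟦ π , ρ ⟧ * inverse g ⟦ ρ , σ ⟧) (allNC n) ≈⟨ ⋆-⟦⟧ e (inverse g) π σ ⟨
      (e ⋆ inverse g) ⟦ π , σ ⟧     ≈⟨ ⟦⟧-cong (⋆-identityˡ (inverse g)) ⟩
      inverse g ⟦ π , σ ⟧           ≈⟨ inverse-fixpoint π σ ⟩
      e ⟦ π , σ ⟧ + D               ≈⟨ +-comm _ _ ⟩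
      D + e ⟦ π , σ ⟧               ∎)
      where
      defect-+ : .{{_ : NonZero n}} (π ρ : NC n) → defect g ⟦ π , ρ ⟧ + g ⟦ π , ρ ⟧ ≈ e ⟦ π , ρ ⟧
      defect-+ π ρ = begin
        defect g ⟦ π , ρ ⟧ + g ⟦ π , ρ ⟧              ≈⟨ +-congʳ (defect-⟦⟧ g π ρ) ⟩
        (e ⟦ π , ρ ⟧ - g ⟦ π , ρ ⟧) + g ⟦ π , ρ ⟧    ≈⟨ +-assoc _ _ _ ⟩
        e ⟦ π , ρ ⟧ + (- g ⟦ π , ρ ⟧ + g ⟦ π , ρ ⟧)  ≈⟨ +-congˡ (-‿inverseˡ _) ⟩
        e ⟦ π , ρ ⟧ + 0#                              ≈⟨ +-identityʳ _ ⟩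
        e ⟦ π , ρ ⟧                                   ∎

  ⋆-cancelˡ : f ⋆ g ≐ e → g ⋆ h ≐ e → f ≐ h
  ⋆-cancelˡ {f} {g} {h} fg≐e gh≐e =
    ≐-trans (≐-sym (⋆-identityʳ f)) (≐-trans (⋆-cong ≐-refl (≐-sym gh≐e)) (≐-trans (≐-sym (⋆-assoc f g h))
      (≐-trans (⋆-cong fg≐e ≐-refl) (⋆-identityˡ h))))

  -- A right inverse h of g has a right inverse of its own, which is g.
  inverseˡ : ∀ g → Unital g → inverse g ⋆ g ≐ e
  inverseˡ g g-unital = ≐-trans (⋆-cong ≐-refl g≐g″) hg″≐e
    where
    hg″≐e : inverse g ⋆ inverse (inverse g) ≐ e
    hg″≐e = inverseʳ (inverse g) (inverse-unital g g-unital)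

    g≐g″ : g ≐ inverse (inverse g)
    g≐g″ = ⋆-cancelˡ (inverseʳ g g-unital) hg″≐e

  -- Multiplicativity

  𝒢-unital : 𝒢 g → Unital g
  𝒢-unital {g} g∈𝒢 π = ≈-trans (reflexive (⟦⟧-⊑ g (⊑-refl π))) (𝒢.unital g∈𝒢 π)

  factor : Fun → (σ π ρ : NC n) → Fin n → Carrier
  factor g σ π ρ i = _⟦_,_⟧ g {{∣block∣≢0 σ i}} (π ↾ block σ i) (ρ ↾ block σ i)

  factor𝟙 : Fun → (σ π : NC n) → Fin n → Carrier
  factor𝟙 g σ π i = _⟦_,_⟧ g {{∣block∣≢0 σ i}} (π ↾ block σ i) 𝟙

  factor𝟙-⟨⟩ : ∀ g (σ π : NC n) i → factor𝟙 g σ π i ≡ g (⟨_,𝟙⟩ {{∣block∣≢0 σ i}} (π ↾ block σ i))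
  factor𝟙-⟨⟩ g σ π i = ⟦⟧-⊑ {{∣block∣≢0 σ i}} g (⊑-𝟙 (π ↾ block σ i))

  -- The product formula with the two occurrences of the function separated; for `g` itself it is
  -- `Extends g g`. This lets `extension h` be used without first comparing it with `h` at upper end
  -- `𝟙`.
  Extends : Fun → Fun → Set ℓ
  Extends f h = ∀ {n} .{{_ : NonZero n}} {π σ : NC n} → π ⊑ σ → f ⟦ π , σ ⟧ ≈ prod (factor𝟙 h σ π) (leasts σ)

  𝒢-extends : 𝒢 g → Extends g g
  𝒢-extends {g} g∈𝒢 {π = π} {σ} π⊑σ = begin
    g ⟦ π , σ ⟧                   ≡⟨ ⟦⟧-⊑ g π⊑σ ⟩
    g (pair π σ (⊑⇒≼ π⊑σ))        ≈⟨ 𝒢.multiplicative g∈𝒢 π σ (⊑⇒≼ π⊑σ) ⟩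
    prod (λ i → g (⟨_,𝟙⟩ {{∣block∣≢0 σ i}} (π ↾ block σ i))) (leasts σ)
      ≈⟨ prod-cong {xs = leasts σ} (λ {i} _ → reflexive (factor𝟙-⟨⟩ g σ π i)) ⟨
    prod (factor𝟙 g σ π) (leasts σ) ∎

  mk𝒢 : Unital g → Extends g g → 𝒢 g
  mk𝒢 {g} g-unital g-extends = record
    { unital         = λ π → ≈-trans (≈-sym (reflexive (⟦⟧-⊑ g (⊑-refl π)))) (g-unital π)
    ; multiplicative = λ π σ π≼σ → let π⊑σ = recompute-⊑ π≼σ in begin
        g (pair π σ _)                  ≡⟨ ⟦⟧-⊑ g π⊑σ ⟨
        g ⟦ π , σ ⟧                     ≈⟨ g-extends π⊑σ ⟩
        prod (factor𝟙 g σ π) (leasts σ) ≈⟨ prod-cong {xs = leasts σ} (λ {i} _ → reflexive (factor𝟙-⟨⟩ g σ π i)) ⟩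
        prod (λ i → g (⟨_,𝟙⟩ {{∣block∣≢0 σ i}} (π ↾ block σ i))) (leasts σ) ∎
    }

  -- Points related by `π` share a block of `σ`, so a failure of refinement is visible inside one
  -- block. It supplies the zero factor of a product.
  ⋢-block : {π ρ σ : NC n} → π ⊑ σ → ¬ π ⊑ ρ → ∃[ i ] i ∈ˡ leasts σ × ¬ π ↾ block σ i ⊑ ρ ↾ block σ i
  ⋢-block {π = π} {ρ} {σ} π⊑σ π⋢ρ
    with x , y , x∼y , x≁y ← ⋢-witness π ρ π⋢ρ
    with i , i∈ , x∈W ← leasts-cover σ x = i , i∈ , λ πW⊑ρW →
      x≁y (≡.subst₂ (SameBlock ρ) (enum-index x∈W) (enum-index y∈W′)
        (↾⁻ ρ W (coarsen πW⊑ρW (↾⁺ π W (≡.subst₂ (SameBlock π) (sym (enum-index x∈W)) (sym (enum-index y∈W′)) x∼y)))))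
    where
    W = block σ i

    y∈W′ : y ∈ W
    y∈W′ = block-closed π⊑σ i x∈W x∼y

  module _ .{{_ : NonZero n}} where

    -- The product formula at `(π , ρ)` runs over the blocks of `ρ`. Grouped by the blocks of `σ`,
    -- each group is the product formula for the restricted pair.
    𝒢-factor-⊑ : 𝒢 g → {π ρ σ : NC n} → π ⊑ ρ → ρ ⊑ σ → g ⟦ π , ρ ⟧ ≈ prod (factor g σ π ρ) (leasts σ)
    𝒢-factor-⊑ {g} g∈𝒢 {π} {ρ} {σ} π⊑ρ ρ⊑σ = begin
      g ⟦ π , ρ ⟧                           ≈⟨ 𝒢-extends g∈𝒢 π⊑ρ ⟩
      prod (factor𝟙 g ρ π) (leasts ρ)       ≈⟨ prod-↭ (leasts-refine ρ⊑σ) ⟩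
      prod (factor𝟙 g ρ π) (concatMap (λ i → List.map (enum (block σ i)) (leasts (ρ ↾ block σ i))) (leasts σ))
        ≈⟨ prod-concatMap _ (leasts σ) ⟩
      prod (λ i → prod (factor𝟙 g ρ π) (List.map (enum (block σ i)) (leasts (ρ ↾ block σ i)))) (leasts σ)
        ≈⟨ prod-cong {xs = leasts σ} (λ {i} _ → step i) ⟩
      prod (factor g σ π ρ) (leasts σ)      ∎
      where
      step : ∀ i → prod (factor𝟙 g ρ π) (List.map (enum (block σ i)) (leasts (ρ ↾ block σ i))) ≈ factor g σ π ρ i
      step i = begin
        prod (factor𝟙 g ρ π) (List.map (enum W) (leasts (ρ ↾ W))) ≈⟨ prod-map (enum W) (leasts (ρ ↾ W)) ⟩
        prod (λ a → factor𝟙 g ρ π (enum W a)) (leasts (ρ ↾ W))    ≈⟨ prod-cong {xs = leasts (ρ ↾ W)} (λ {a} _ → reflexive (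
          trans (factor𝟙-⟨⟩ g ρ π (enum W a)) (trans (cong g (sym (↾-block-↾ ρ⊑σ π i a)))
            (sym (factor𝟙-⟨⟩ g (ρ ↾ W) (π ↾ W) a))))) ⟩
        prod (factor𝟙 g (ρ ↾ W) (π ↾ W)) (leasts (ρ ↾ W))
          ≈⟨ 𝒢-extends g∈𝒢 {{∣block∣≢0 σ i}} (↾-mono-⊑ π⊑ρ W) ⟨
        factor g σ π ρ i ∎
        where
        W = block σ i

    -- Sums over families of pieces meet every `ρ ⊑ σ`, including those not above `π`. There the
    -- left side is zero by convention and the right side by `⋢-block`.
    𝒢-factor : 𝒢 g → {π ρ σ : NC n} → π ⊑ σ → ρ ⊑ σ → g ⟦ π , ρ ⟧ ≈ prod (factor g σ π ρ) (leasts σ)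
    𝒢-factor {g} g∈𝒢 {π} {ρ} {σ} π⊑σ ρ⊑σ = by-cases (π ⊑? ρ)
      where
      by-cases : Dec (π ⊑ ρ) → g ⟦ π , ρ ⟧ ≈ prod (factor g σ π ρ) (leasts σ)
      by-cases (yes π⊑ρ) = 𝒢-factor-⊑ g∈𝒢 π⊑ρ ρ⊑σ
      by-cases (no π⋢ρ)  = let i , i∈ , ⋢i = ⋢-block π⊑σ π⋢ρ in
        ≈-trans (reflexive (⟦⟧-⋢ g π⋢ρ)) (≈-sym (prod-0 i∈ (reflexive (⟦⟧-⋢ {{∣block∣≢0 σ i}} g ⋢i))))

  ↾-block : (σ : NC n) (i : Fin n) → σ ↾ block σ i ≡ 𝟙
  ↾-block σ i = NC-ext (λ _ → 𝟙-∼ _ _)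
    (λ {a} {b} _ → ↾⁺ σ W (∼-trans σ (∼-sym σ (enum-∈ W a)) (enum-∈ W b)))
    where
    W = block σ i

  e-extends : Extends e e
  e-extends {π = π} {σ} π⊑σ = by-cases (π ≟ σ)
    where
    by-cases : Dec (π ≡ σ) → e ⟦ π , σ ⟧ ≈ prod (factor𝟙 e σ π) (leasts σ)
    by-cases (yes refl) = ≈-trans (e-diagonal π) (≈-sym (prod-1 {xs = leasts π} λ {i} _ →
      ≈-trans (reflexive (cong (λ τ → _⟦_,_⟧ e {{∣block∣≢0 π i}} τ 𝟙) (↾-block π i))) (e-diagonal {{∣block∣≢0 π i}} 𝟙)))
    -- `σ ⋢ π` shows up in some block of `σ`, and on that block `π` cannot restrict to `𝟙`.
    by-cases (no π≢σ)   = let i , i∈ , σi⋢πi = ⋢-block (⊑-refl σ) (⊑∧≢⇒⋣ π⊑σ π≢σ) in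
      ≈-trans (e-off-diagonal π≢σ) (≈-sym (prod-0 i∈ (e-off-diagonal {{∣block∣≢0 σ i}} λ πi≡𝟙 →
        σi⋢πi (subst (σ ↾ block σ i ⊑_) (sym πi≡𝟙) (⊑-𝟙 (σ ↾ block σ i))))))

  -- Sums over the partitions finer than `σ`

  sum-cartesianProductWith : {C : Set} (F : C → Carrier) (f : A → B → C) (xs : List A) (ys : List B) →
    sum F (cartesianProductWith f xs ys) ≈ sum (λ x → sum (λ y → F (f x y)) ys) xs
  sum-cartesianProductWith F f []       ys = ≈-refl
  sum-cartesianProductWith F f (x ∷ xs) ys = begin
    sum F (List.map (f x) ys ++ cartesianProductWith f xs ys) ≈⟨ sum-++ (List.map (f x) ys) _ ⟩
    sum F (List.map (f x) ys) + sum F (cartesianProductWith f xs ys)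
      ≈⟨ +-cong (sum-map (f x) ys) (sum-cartesianProductWith F f xs ys) ⟩
    sum (λ y → F (f x y)) ys + sum (λ x → sum (λ y → F (f x y)) ys) xs ∎

  module _ (σ : NC n) where

    open Gluing σ

    familyProd : (∀ i → Piece i → Carrier) → ∀ {is} → All Piece is → Carrier
    familyProd F []           = 1#
    familyProd F (_∷_ {i} τ τs) = F i τ * familyProd F τs

    familyProd-restrict : ∀ F ρ is → familyProd F (restrict ρ is) ≡ prod (λ i → F i (ρ ↾ block σ i)) is
    familyProd-restrict F ρ []       = refl
    familyProd-restrict F ρ (i ∷ is) = cong (F i (ρ ↾ block σ i) *_) (familyProd-restrict F ρ is)

    sum-familyProd : ∀ F is → sum (familyProd F) (choices is) ≈ prod (λ i → sum (F i) (allNC _)) is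
    sum-familyProd F []       = +-identityʳ 1#
    sum-familyProd F (i ∷ is) = begin
      sum (familyProd F) (choices (i ∷ is)) ≈⟨ sum-cartesianProductWith (familyProd F) _∷_ (allNC _) (choices is) ⟩
      sum (λ τ → sum (λ τs → F i τ * familyProd F τs) (choices is)) (allNC _)
        ≈⟨ sum-cong {xs = allNC _} (λ {τ} _ → sum-*ˡ (F i τ) (familyProd F) (choices is)) ⟨
      sum (λ τ → F i τ * sum (familyProd F) (choices is)) (allNC _)
        ≈⟨ sum-*ʳ (sum (familyProd F) (choices is)) (F i) (allNC _) ⟨
      sum (F i) (allNC _) * sum (familyProd F) (choices is) ≈⟨ *-congˡ (sum-familyProd F is) ⟩
      prod (λ i → sum (F i) (allNC _)) (i ∷ is) ∎

    sum-finer : (G : NC n → Carrier) → (∀ {ρ} → ¬ ρ ⊑ σ → G ρ ≈ 0#) →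
      ∀ F → (∀ {ρ} → ρ ⊑ σ → G ρ ≈ prod (λ i → F i (ρ ↾ block σ i)) (leasts σ)) →
      sum G (allNC n) ≈ prod (λ i → sum (F i) (allNC _)) (leasts σ)
    sum-finer G G-support F G≈F = begin
      sum G (allNC n)                            ≈⟨ sum-filter (_⊑? σ) (allNC n) G-support ⟩
      sum G (filter (_⊑? σ) (allNC n))           ≈⟨ sum-↭ finer-↭ ⟩
      sum G (List.map glue (choices (leasts σ))) ≈⟨ sum-map glue (choices (leasts σ)) ⟩
      sum (λ τs → G (glue τs)) (choices (leasts σ))
        ≈⟨ sum-cong {xs = choices (leasts σ)} (λ {τs} _ → ≈-trans (G≈F (glue-⊑ τs)) (reflexive
             (trans (sym (familyProd-restrict F (glue τs) (leasts σ))) (cong (familyProd F) (restrict-glue τs))))) ⟩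
      sum (familyProd F) (choices (leasts σ))    ≈⟨ sum-familyProd F (leasts σ) ⟩
      prod (λ i → sum (F i) (allNC _)) (leasts σ) ∎

  -- The hypotheses are asymmetric: `g` is evaluated at `(π , ρ)` and must factor over the blocks of
  -- `σ`, while `f` occurs only with upper end `σ`, where `Extends` already gives the factors. So
  -- `f` may be the extension of `inverse g`, not yet known to lie in `𝒢`.
  ⋆-extends : 𝒢 g → Extends f h → Extends (g ⋆ f) (g ⋆ h)
  ⋆-extends {g} {f} {h} g∈𝒢 f-extends {n} {π} {σ} π⊑σ = begin
    (g ⋆ f) ⟦ π , σ ⟧ ≈⟨ ⋆-⟦⟧ g f π σ ⟩
    sum (λ ρ → g ⟦ π , ρ ⟧ * f ⟦ ρ , σ ⟧) (allNC n)
      ≈⟨ sum-finer σ _ (λ ρ⋢σ → ⟦⟧-*-outside g f (ρ⋢σ ∘ proj₂)) F (λ {ρ} ρ⊑σ → begin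
           g ⟦ π , ρ ⟧ * f ⟦ ρ , σ ⟧ ≈⟨ *-cong (𝒢-factor g∈𝒢 π⊑σ ρ⊑σ) (f-extends ρ⊑σ) ⟩
           prod (factor g σ π ρ) (leasts σ) * prod (factor𝟙 h σ ρ) (leasts σ) ≈⟨ prod-* (leasts σ) ⟨
           prod (λ i → F i (ρ ↾ block σ i)) (leasts σ) ∎) ⟩
    prod (λ i → sum (F i) (allNC _)) (leasts σ)
      ≈⟨ prod-cong {xs = leasts σ} (λ {i} _ → ⋆-⟦⟧ {{∣block∣≢0 σ i}} g h (π ↾ block σ i) 𝟙) ⟨
    prod (factor𝟙 (g ⋆ h) σ π) (leasts σ) ∎
    where
    F : ∀ i → NC ∣ block σ i ∣ → Carrier
    F i τ = _⟦_,_⟧ g {{∣block∣≢0 σ i}} (π ↾ block σ i) τ * _⟦_,_⟧ h {{∣block∣≢0 σ i}} τ 𝟙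

  ⋆-unital : Unital f → Unital g → Unital (f ⋆ g)
  ⋆-unital {f} {g} f-unital g-unital {n} π = begin
    (f ⋆ g) ⟦ π , π ⟧ ≈⟨ ⋆-⟦⟧ f g π π ⟩
    sum (λ ρ → f ⟦ π , ρ ⟧ * g ⟦ ρ , π ⟧) (allNC n) ≈⟨ sum-single (allNC-unique n) (allNC-complete π) (λ _ ρ≢π →
      ⟦⟧-*-outside f g λ (π⊑ρ , ρ⊑π) → ρ≢π (⊑-antisym ρ⊑π π⊑ρ)) ⟩
    f ⟦ π , π ⟧ * g ⟦ π , π ⟧ ≈⟨ *-cong (f-unital π) (g-unital π) ⟩
    1# * 1# ≈⟨ *-identityˡ 1# ⟩
    1# ∎

  ⋆-𝒢 : 𝒢 f → 𝒢 g → 𝒢 (f ⋆ g)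
  ⋆-𝒢 f∈𝒢 g∈𝒢 = mk𝒢 (⋆-unital (𝒢-unital f∈𝒢) (𝒢-unital g∈𝒢)) (⋆-extends f∈𝒢 (𝒢-extends g∈𝒢))

  -- Identifies `g ⋆ extension (inverse g)` with `e`: by `⋆-extends` the former extends
  -- `g ⋆ inverse g`, that is `e`, and `e` extends itself.
  Extends-unique : Extends f h → Extends g h → f ≐ g
  Extends-unique f-extends g-extends = ⟦⟧-≐ λ π⊑σ → ≈-trans (f-extends π⊑σ) (≈-sym (g-extends π⊑σ))

  Extends-cong : f ≐ g → Extends f h → Extends g h
  Extends-cong f≐g f-extends π⊑σ = ≈-trans (≈-sym (⟦⟧-cong f≐g)) (f-extends π⊑σ)

  Extends-congʳ : g ≐ h → Extends f g → Extends f h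
  Extends-congʳ g≐h f-extends {σ = σ} π⊑σ = ≈-trans (f-extends π⊑σ)
    (prod-cong {xs = leasts σ} λ {i} _ → ⟦⟧-cong {{∣block∣≢0 σ i}} g≐h)

  extension : Fun → Fun
  extension h (pair π σ _) = prod (factor𝟙 h σ π) (leasts σ)

  extension-extends : ∀ h → Extends (extension h) h
  extension-extends h π⊑σ = reflexive (⟦⟧-⊑ (extension h) π⊑σ)

  -- The multiplicative extension of g⁻¹ is a right inverse of g, hence
  -- equal to g⁻¹.
  inverse-𝒢 : 𝒢 g → 𝒢 (inverse g)
  inverse-𝒢 {g} g∈𝒢 = mk𝒢 (inverse-unital g g-unital) (Extends-cong (≐-sym g⁻¹≐extension) (extension-extends g⁻¹))
    where
    g⁻¹ = inverse g

    g-unital : Unital g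
    g-unital = 𝒢-unital g∈𝒢

    g⋆extension≐e : g ⋆ extension g⁻¹ ≐ e
    g⋆extension≐e = Extends-unique
      (Extends-congʳ (inverseʳ g g-unital) (⋆-extends g∈𝒢 (extension-extends g⁻¹))) e-extends

    g⁻¹≐extension : g⁻¹ ≐ extension g⁻¹
    g⁻¹≐extension = ⋆-cancelˡ (inverseˡ g g-unital) g⋆extension≐e

  -- Functions of cumulant-to-cumulant type

  -- The points `x` and `y` show that both sides of the cut are inhabited, so the concatenation
  -- recovered from it has two non-empty halves, as `𝒢-cc.vanishes-◇` demands.
  vanishes-at-cut : 𝒢-cc g → .{{_ : NonZero n}} (p : Fin n → Bool) → Cut p → ∀ {x y} → p x ≡ false → p y ≡ true →
                    (π : NC n) → Respects p π → g ⟦ π , 𝟙 ⟧ ≈ 0#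
  vanishes-at-cut {g} g∈cc p cut {x} {y} px py π respects
    with c , c≤n , left , right ← threshold p cut
    with d , refl ← ℕ.m≤n⇒∃[o]m+o≡n c≤n
    with π₁ , π₂ , refl ← separated⇒◇ {c} {d} π (λ a b a∼b → respects a∼b
           (left _ (subst (ℕ._< c) (sym (Fin.toℕ-↑ˡ a d)) (Fin.toℕ<n a)))
           (right _ (subst (c ℕ.≤_) (sym (Fin.toℕ-↑ʳ c b)) (ℕ.m≤m+n c (toℕ b))))) =
    ≈-trans (reflexive (⟦⟧-⊑ {{m+n≢0 c {{c≢0}}}} g (⊑-𝟙 (π₁ ◇ π₂)))) (𝒢-cc.vanishes-◇ g∈cc {{c≢0}} {{d≢0}} π₁ π₂)
    where
    c≢0 : NonZero c
    c≢0 = ℕ.≢-nonZero λ { refl → contradiction (trans (sym px) (right x z≤n)) λ () }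

    d≢0 : NonZero d
    d≢0 = ℕ.≢-nonZero λ { refl → contradiction
      (trans (sym py) (left y (subst (toℕ y ℕ.<_) (ℕ.+-identityʳ c) (Fin.toℕ<n y)))) λ () }

  module _ .{{_ : NonZero n}} (p : Fin n → Bool) (cut : Cut p) where

    -- A block of ρ meeting both sides of the cut contributes a vanishing
    -- factor.
    vanishes-at-straddling : 𝒢-cc g → {π ρ : NC n} → Respects p π →
      ∀ {x y} → x ∼[ ρ ] y → p x ≡ false → p y ≡ true → g ⟦ π , ρ ⟧ ≈ 0#
    vanishes-at-straddling {g} g∈cc {π} {ρ} respects {x} {y} x∼y px py = by-cases (π ⊑? ρ) (leasts-cover ρ x)
      where
      by-cases : Dec (π ⊑ ρ) → ∃[ i ] i ∈ˡ leasts ρ × x ∈ block ρ i → g ⟦ π , ρ ⟧ ≈ 0#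
      by-cases (no π⋢ρ)  _              = reflexive (⟦⟧-⋢ g π⋢ρ)
      by-cases (yes π⊑ρ) (i , i∈ , x∈W) =
        ≈-trans (𝒢-extends (𝒢-cc.∈𝒢 g∈cc) π⊑ρ) (prod-0 i∈ (vanishes-at-cut g∈cc {{∣block∣≢0 ρ i}}
          (p ∘ enum W) (cut ∘ enum-mono-< W)
          (trans (cong p (enum-index x∈W)) px) (trans (cong p (enum-index y∈W)) py)
          (π ↾ W) (respects ∘ ↾⁻ π W)))
        where
        W = block ρ i

        y∈W : y ∈ W
        y∈W = ∼-trans ρ x∈W x∼y

    -- Abstract in `F` and `G` because it serves two convolutions: `f ⋆ g`, and
    -- `defect g ⋆ partialSum g k` in the induction for the inverse.
    sum-at-cut : (F G : NC n → Carrier) →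
      (∀ {ρ x y} → x ∼[ ρ ] y → p x ≡ false → p y ≡ true → F ρ ≈ 0#) →
      (∀ {ρ} → Respects p ρ → G ρ ≈ 0#) → sum (λ ρ → F ρ * G ρ) (allNC n) ≈ 0#
    sum-at-cut F G F-straddling G-respecting = sum-0 {xs = allNC n} λ {ρ} _ → by-cases ρ
      (any? λ x → any? λ y → SameBlock? ρ x y ×-dec (p x Bool.≟ false) ×-dec (p y Bool.≟ true))
      where
      by-cases : ∀ ρ → Dec (∃[ x ] ∃[ y ] x ∼[ ρ ] y × p x ≡ false × p y ≡ true) → F ρ * G ρ ≈ 0#
      by-cases ρ (yes (x , y , x∼y , px , py)) = ≈-trans (*-congʳ (F-straddling x∼y px py)) (zeroˡ _)
      by-cases ρ (no ¬straddling) =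
        ≈-trans (*-congˡ (G-respecting λ x∼y px py → ¬straddling (_ , _ , x∼y , px , py))) (zeroʳ _)

    module _ {x y : Fin n} (px : p x ≡ false) (py : p y ≡ true) where

      ⋆-vanishes-at-cut : 𝒢-cc f → 𝒢-cc g → {π : NC n} → Respects p π → (f ⋆ g) ⟦ π , 𝟙 ⟧ ≈ 0#
      ⋆-vanishes-at-cut {f} {g} f∈cc g∈cc {π} respects = ≈-trans (⋆-⟦⟧ f g π 𝟙)
        (sum-at-cut (λ ρ → f ⟦ π , ρ ⟧) (λ ρ → g ⟦ ρ , 𝟙 ⟧)
          (vanishes-at-straddling f∈cc respects) (vanishes-at-cut g∈cc p cut px py _))

      partialSum-vanishes-at-cut : 𝒢-cc g → ∀ k {π : NC n} → Respects p π → partialSum g k ⟦ π , 𝟙 ⟧ ≈ 0#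
      partialSum-vanishes-at-cut {g} g∈cc zero    {π} respects = reflexive (⟦⟧-⊑ (partialSum g zero) (⊑-𝟙 π))
      partialSum-vanishes-at-cut {g} g∈cc (suc k) {π} respects = begin
        partialSum g (suc k) ⟦ π , 𝟙 ⟧ ≈⟨ partialSum-⟦⟧ g k π 𝟙 ⟩
        e ⟦ π , 𝟙 ⟧ + sum (λ ρ → defect g ⟦ π , ρ ⟧ * partialSum g k ⟦ ρ , 𝟙 ⟧) (allNC n)
          -- `𝟙` joins `x` to `y`, so it straddles the cut and differs from `π`.
          ≈⟨ +-cong (e-straddling (𝟙-∼ x y) px py) (sum-at-cut (λ ρ → defect g ⟦ π , ρ ⟧) (λ ρ → partialSum g k ⟦ ρ , 𝟙 ⟧)
               straddling (partialSum-vanishes-at-cut g∈cc k)) ⟩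
        0# + 0# ≈⟨ +-identityˡ 0# ⟩
        0# ∎
        where
        -- A partition that respects the cut cannot equal one that straddles it, so passing from `g`
        -- to `e - g` keeps the vanishing at straddling `ρ`.
        e-straddling : ∀ {ρ x y} → x ∼[ ρ ] y → p x ≡ false → p y ≡ true → e ⟦ π , ρ ⟧ ≈ 0#
        e-straddling x∼y px py = e-off-diagonal λ { refl → respects x∼y px py }

        straddling : ∀ {ρ x y} → x ∼[ ρ ] y → p x ≡ false → p y ≡ true → defect g ⟦ π , ρ ⟧ ≈ 0#
        straddling {ρ} x∼y px py = begin
          defect g ⟦ π , ρ ⟧         ≈⟨ defect-⟦⟧ g π ρ ⟩
          e ⟦ π , ρ ⟧ - g ⟦ π , ρ ⟧  ≈⟨ +-cong (e-straddling x∼y px py) (-‿cong (vanishes-at-straddling g∈cc respects x∼y px py)) ⟩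
          0# - 0#                    ≈⟨ -‿inverseʳ 0# ⟩
          0#                         ∎

  module _ (m : ℕ) .{{_ : NonZero m}} .{{_ : NonZero n}} (π₁ : NC m) (π₂ : NC n) where

    private
      instance
        m+n-nonZero : NonZero (m ℕ.+ n)
        m+n-nonZero = m+n≢0 m

    vanishes-◇ : (∀ (p : Fin (m ℕ.+ n) → Bool) → Cut p → ∀ {x y} → p x ≡ false → p y ≡ true →
                  ∀ {π} → Respects p π → g ⟦ π , 𝟙 ⟧ ≈ 0#) → g ⟨ π₁ ◇ π₂ ,𝟙⟩ ≈ 0#
    vanishes-◇ {g} vanishes = ≈-trans (reflexive (sym (⟦⟧-⊑ g (⊑-𝟙 (π₁ ◇ π₂)))))
      -- The witnesses for the two sides are the first points of the two halves.
      (vanishes (isRight m) (isRight-Cut m) (isRight-↑ˡ m (Fin.fromℕ< (ℕ.>-nonZero⁻¹ m)))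
        (isRight-↑ʳ m (Fin.fromℕ< (ℕ.>-nonZero⁻¹ n))) (◇-Respects m π₁ π₂))

  ⋆-𝒢-cc : 𝒢-cc f → 𝒢-cc g → 𝒢-cc (f ⋆ g)
  ⋆-𝒢-cc f∈cc g∈cc = record
    { ∈𝒢         = ⋆-𝒢 (𝒢-cc.∈𝒢 f∈cc) (𝒢-cc.∈𝒢 g∈cc)
    ; vanishes-◇ = λ {m} π₁ π₂ → vanishes-◇ m π₁ π₂ λ p cut px py →
        ⋆-vanishes-at-cut {{m+n≢0 m}} p cut px py f∈cc g∈cc
    }

  -- At `(π , 𝟙)` the inverse is a partial sum whose length depends on `π`, which is why the
  -- vanishing was proved for every `k`.
  inverse-𝒢-cc : 𝒢-cc g → 𝒢-cc (inverse g)
  inverse-𝒢-cc {g} g∈cc = record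
    { ∈𝒢         = inverse-𝒢 (𝒢-cc.∈𝒢 g∈cc)
    ; vanishes-◇ = λ {m} π₁ π₂ → vanishes-◇ m π₁ π₂ λ p cut px py {π} respects → ≈-trans
        (inverse-⟦⟧ g (𝒢-unital (𝒢-cc.∈𝒢 g∈cc)) {{m+n≢0 m}} (suc (corank π)) π 𝟙 (ℕ.n<1+n _))
        (partialSum-vanishes-at-cut {{m+n≢0 m}} p cut px py g∈cc (suc (corank π)) respects)
    }

proposition8p2 : ∀ {c ℓ} (R : CommutativeRing c ℓ) → let open Functions R in
    (∀ g₁ g₂ → 𝒢-cc g₁ → 𝒢-cc g₂ → 𝒢-cc (g₁ ⋆ g₂)) ×
    (∀ g → 𝒢-cc g → ∃[ g⁻¹ ] IsInverse g g⁻¹ × 𝒢-cc g⁻¹)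
proposition8p2 R = (λ _ _ → ⋆-𝒢-cc) , λ g g∈cc →
  let g-unital = 𝒢-unital (Functions.𝒢-cc.∈𝒢 g∈cc) in
  inverse g , (inverseʳ g g-unital , inverseˡ g g-unital) , inverse-𝒢-cc g∈cc
  where
  open Convolution R
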